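{- Let $k\ge1$ and let $M\subseteq\mathbb{N}^k$ be an infinite set definable in $(\mathbb{N},+)$. Then there is a unique natural number $l$ such that there exists a bijection between $M$ and $\mathbb{N}^l$ definable in $(\mathbb{N},+)$; moreover $1\le l\le k$.
   Context: Definable means first-order definable in $(\mathbb{N},+)$ without parameters (a bijection is definable if its graph is). -}

module Defs where

open import Data.Nat using (ℕ; suc; _+_)
open import Data.Fin using (Fin)
open import Data.Vec using (Vec; _∷_; lookup; _++_)
open import Data.Product using (Σ; _×_; _,_; ∃)
open import Data.Sum using (_⊎_)
open import Data.Empty using (⊥)
open import Data.List using (List)
open import Data.List.Membership.Propositional using (_∈_)
open import Relation.Binary.PropositionalEquality using (_≡_)
open import Relation.Nullary using (¬_)

-- First-order language of (ℕ,+): only the binary function symbol + and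
-- equality; no constants (definability is parameter-free).
-- Terms/formulas with n free variables (de Bruijn indices; index 0 is the
-- innermost bound variable).
data Term (n : ℕ) : Set where
  var  : Fin n → Term n
  _⊕_  : Term n → Term n → Term n

data Formula (n : ℕ) : Set where
  _≐_  : Term n → Term n → Formula n
  ~_   : Formula n → Formula n
  _∧'_ : Formula n → Formula n → Formula n
  _∨'_ : Formula n → Formula n → Formula n
  ∃'   : Formula (suc n) → Formula n
  ∀'   : Formula (suc n) → Formula n

evalT : ∀ {n} → Term n → Vec ℕ n → ℕ
evalT (var i) ρ = lookup ρ i
evalT (s ⊕ t) ρ = evalT s ρ + evalT t ρ

Sat : ∀ {n} → Formula n → Vec ℕ n → Set
Sat (s ≐ t)   ρ = evalT s ρ ≡ evalT t ρ
Sat (~ φ)     ρ = ¬ Sat φ ρ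
Sat (φ ∧' ψ)  ρ = Sat φ ρ × Sat ψ ρ
Sat (φ ∨' ψ)  ρ = Sat φ ρ ⊎ Sat ψ ρ
Sat (∃' φ)    ρ = Σ ℕ λ a → Sat φ (a ∷ ρ)
Sat (∀' φ)    ρ = (a : ℕ) → Sat φ (a ∷ ρ)

Definable : ∀ {k} → (Vec ℕ k → Set) → Set
Definable {k} M = Σ (Formula k) λ φ → ∀ x → (M x → Sat φ x) × (Sat φ x → M x)

Finite : ∀ {k} → (Vec ℕ k → Set) → Set
Finite {k} M = Σ (List (Vec ℕ k)) λ L → ∀ x → M x → x ∈ L

Infinite : ∀ {k} → (Vec ℕ k → Set) → Set
Infinite M = ¬ Finite M

IsBijGraph : ∀ {k l} → (Vec ℕ k → Set) → (Vec ℕ k → Vec ℕ l → Set) → Set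
IsBijGraph {k} {l} M G =
  (∀ x y → G x y → M x)
  × (∀ x → M x → Σ (Vec ℕ l) λ y → G x y × (∀ y' → G x y' → y' ≡ y))
  × (∀ y → Σ (Vec ℕ k) λ x → (M x × G x y) × (∀ x' → M x' → G x' y → x' ≡ x))

DefBij : ∀ {k} → (Vec ℕ k → Set) → ℕ → Set
DefBij {k} M l =
  Σ (Formula (k + l)) λ φ → IsBijGraph M (λ x y → Sat φ (x ++ y))

{-# OPTIONS --safe #-}
module Submission where

-- Cooper's elimination, done semantically: a definable set is decidable and depends only on the
-- signs of finitely many integer affine forms and on residues modulo some D; moreover a
-- witness of an existential quantifier can be bounded linearly in the parameters.
-- Existence.  Affine substitutions cut ℕ^m into copies of ℕ^m and ℕ^(m-1): by residues of a
-- coordinate, by comparing two coordinates, or by testing a coordinate for 0.  Cutting until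
-- all forms have constant sign and all residues are fixed splits M into finitely many affine
-- copies of powers ℕ^a; copies are then merged two at a time, the larger power absorbing the other.
-- Uniqueness.  Definable functions have linear growth, so a definable injection ℕ^l → ℕ^k maps
-- a box with N^l points into a box with O(N^k) points, whence l ≤ k.

open import Defs
open import Data.Nat using (ℕ; zero; suc; NonZero; _≤_; _<_; _/_; _%_; z≤n; s≤s)
import Data.Nat as ℕ
import Data.Nat.Divisibility as ℕ∣
open import Data.Nat.DivMod using (m≡m%n+[m/n]*n; m%n<n; [m+kn]%n≡m%n; m<n⇒m%n≡m)
open import Data.Nat.Induction using (<-wellFounded)
open import Data.Nat.ListAction using (sum)
import Data.Nat.Properties as ℕₚ
open import Data.Nat.Tactic.RingSolver using () renaming (solve-∀ to solveℕ-∀)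
open import Data.Integer using (ℤ; +_; -[1+_]; _+_; _*_; -_; _-_; _⊖_; ∣_∣; 0ℤ; 1ℤ; -1ℤ)
import Data.Integer as ℤ
import Data.Integer.Divisibility.Signed as ℤ∣
import Data.Integer.Properties as ℤₚ
open import Data.Integer.Tactic.RingSolver using (solve-∀)
open import Data.Bool using (Bool; true; false; not)
import Data.Bool.Properties as Boolₚ
open import Data.Fin using (Fin; zero; suc; toℕ; fromℕ<; finToFun; funToFin; combine; punchIn; _↑ˡ_; _↑ʳ_)
import Data.Fin.Properties as Finₚ
open import Data.Vec using (Vec; []; _∷_; lookup; _++_; map; zipWith; replicate; tabulate; allFin; updateAt; insertAt; removeAt)
import Data.Vec as Vec
open import Data.Vec.Properties using (lookup-map; map-∘; map-++; map-cong; map-id; map-updateAt; map-insertAt; map-lookup-allFin; tabulate-∘; tabulate-cong; tabulate∘lookup; lookup∘tabulate; lookup-++ˡ; lookup-++ʳ; ∷-injectiveˡ; ∷-injectiveʳ; sum-++; lookup∘updateAt; lookup∘updateAt′; updateAt-updateAt; updateAt-updateAt-local; updateAt-id-local; insertAt-removeAt; removeAt-insertAt; insertAt-lookup)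
open import Data.List using (List; []; _∷_; concatMap; upTo)
import Data.List as List
import Data.List.Properties as Listₚ
open import Data.List.Membership.Propositional using (_∈_; find; lose)
open import Data.List.Membership.Propositional.Properties using (∈-map⁺; ∈-map⁻; ∈-++⁺ˡ; ∈-++⁺ʳ; ∈-++⁻; ∈-concatMap⁺; ∈-upTo⁺; ∈-allFin)
open import Data.List.Relation.Unary.All using (All; []; _∷_; all?)
import Data.List.Relation.Unary.All as All
import Data.List.Relation.Unary.All.Properties as Allₚ
open import Data.List.Relation.Unary.AllPairs using ([]; _∷_)
open import Data.List.Relation.Unary.Any using (here; there)
open import Data.List.Relation.Unary.Unique.Propositional using (Unique)
import Data.List.Relation.Unary.Unique.Propositional.Properties as Uniqueₚ
open import Data.Product using (Σ; _×_; _,_; proj₁; proj₂)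
open import Data.Sum using (_⊎_; inj₁; inj₂; [_,_]′; swap)
open import Data.Empty using (⊥; ⊥-elim)
open import Function using (_∘_; id)
open import Induction.WellFounded using (Acc; acc)
open import Relation.Binary.PropositionalEquality using (_≡_; _≢_; _≗_; refl; sym; trans; cong; cong₂; subst; subst₂; module ≡-Reasoning)
open import Relation.Nullary using (¬_; Dec; yes; no; ¬?; _×-dec_; _⊎-dec_)
open import Relation.Nullary.Decidable using (map′; decidable-stable)

-- Definability

-- Everything is constructive: `M` is an arbitrary family of types and `Infinite` is a negation, so
-- the alternative "finite, or in bijection with a power" has to be computed. This is why
-- decidability travels with every Presburger set and why the pieces are parametrised by functions
-- rather than by relations. The delicate point is to make the sign of a single form constant. If
-- all its coefficients have the same sign, peeling off coordinates comes to an end; for a form such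
-- as x - y it never does. There, residues are used to rescale two coordinates until a positive and
-- a negative coefficient become opposite, and comparing the two coordinates cancels one of them, so
-- the number of nonzero coefficients drops. Affine substitutions turn forms into forms and keep
-- both their number and the modulus. Hence the forms can be treated one at a time, the others being
-- carried along whatever they become.

infix 2 _⟷_
_⟷_ : Set → Set → Set
A ⟷ B = (A → B) × (B → A)

⟷-trans : ∀ {A B C : Set} → A ⟷ B → B ⟷ C → A ⟷ C
⟷-trans (f , g) (h , k) = h ∘ f , g ∘ k

-- Renamings are vectors of variables, so that the environment seen by a renamed formula is
-- map (lookup v) ρ.
renT : ∀ {n N} → Vec (Fin N) n → Term n → Term N
renT ρ (var i) = var (lookup ρ i)
renT ρ (s ⊕ t) = renT ρ s ⊕ renT ρ t

lift : ∀ {n N} → Vec (Fin N) n → Vec (Fin (suc N)) (suc n)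
lift ρ = zero ∷ map suc ρ

ren : ∀ {n N} → Vec (Fin N) n → Formula n → Formula N
ren ρ (s ≐ t)  = renT ρ s ≐ renT ρ t
ren ρ (~ φ)    = ~ ren ρ φ
ren ρ (φ ∧' ψ) = ren ρ φ ∧' ren ρ ψ
ren ρ (φ ∨' ψ) = ren ρ φ ∨' ren ρ ψ
ren ρ (∃' φ)   = ∃' (ren (lift ρ) φ)
ren ρ (∀' φ)   = ∀' (ren (lift ρ) φ)

evalT-ren : ∀ {n N} (ρ : Vec (Fin N) n) (t : Term n) v → evalT (renT ρ t) v ≡ evalT t (map (lookup v) ρ)
evalT-ren ρ (var i) v = sym (lookup-map i (lookup v) ρ)
evalT-ren ρ (s ⊕ t) v = cong₂ ℕ._+_ (evalT-ren ρ s v) (evalT-ren ρ t v)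

lift-env : ∀ {n N} (ρ : Vec (Fin N) n) a (v : Vec ℕ N) → map (lookup (a ∷ v)) (lift ρ) ≡ a ∷ map (lookup v) ρ
lift-env ρ a v = cong (a ∷_) (sym (map-∘ (lookup (a ∷ v)) suc ρ))

Sat-ren : ∀ {n N} (φ : Formula n) (ρ : Vec (Fin N) n) v → Sat (ren ρ φ) v ⟷ Sat φ (map (lookup v) ρ)
Sat-ren (s ≐ t) ρ v =
  (λ e → trans (sym (evalT-ren ρ s v)) (trans e (evalT-ren ρ t v))) ,
  (λ e → trans (evalT-ren ρ s v) (trans e (sym (evalT-ren ρ t v))))
Sat-ren (~ φ) ρ v = (λ k → k ∘ proj₂ (Sat-ren φ ρ v)) , (λ k → k ∘ proj₁ (Sat-ren φ ρ v))
Sat-ren (φ ∧' ψ) ρ v with Sat-ren φ ρ v | Sat-ren ψ ρ v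
... | f , g | h , k = (λ (a , b) → f a , h b) , (λ (a , b) → g a , k b)
Sat-ren (φ ∨' ψ) ρ v with Sat-ren φ ρ v | Sat-ren ψ ρ v
... | f , g | h , k =
  (λ { (inj₁ a) → inj₁ (f a) ; (inj₂ b) → inj₂ (h b) }) ,
  (λ { (inj₁ a) → inj₁ (g a) ; (inj₂ b) → inj₂ (k b) })
Sat-ren (∃' φ) ρ v =
  (λ (a , s) → a , subst (Sat φ) (lift-env ρ a v) (proj₁ (Sat-ren φ (lift ρ) (a ∷ v)) s)) ,
  (λ (a , s) → a , proj₂ (Sat-ren φ (lift ρ) (a ∷ v)) (subst (Sat φ) (sym (lift-env ρ a v)) s))
Sat-ren (∀' φ) ρ v =
  (λ s a → subst (Sat φ) (lift-env ρ a v) (proj₁ (Sat-ren φ (lift ρ) (a ∷ v)) (s a))) ,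
  (λ s a → proj₂ (Sat-ren φ (lift ρ) (a ∷ v)) (subst (Sat φ) (sym (lift-env ρ a v)) (s a)))

left : ∀ m n → Vec (Fin (m ℕ.+ n)) m
left m n = tabulate (_↑ˡ n)

right : ∀ m n → Vec (Fin (m ℕ.+ n)) n
right m n = tabulate (m ↑ʳ_)

map-left : ∀ {m n} (x : Vec ℕ m) (y : Vec ℕ n) → map (lookup (x ++ y)) (left m n) ≡ x
map-left {m} {n} x y = trans (sym (tabulate-∘ (lookup (x ++ y)) (_↑ˡ n)))
  (trans (tabulate-cong (lookup-++ˡ x y)) (tabulate∘lookup x))

map-shift : ∀ {m n k} (x : Vec ℕ m) (y : Vec ℕ n) (ρ : Vec (Fin n) k) →
  map (lookup (x ++ y)) (map (m ↑ʳ_) ρ) ≡ map (lookup y) ρ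
map-shift x y ρ = trans (sym (map-∘ _ _ ρ)) (map-cong (lookup-++ʳ x y) ρ)

map-right : ∀ {m n} (x : Vec ℕ m) (y : Vec ℕ n) → map (lookup (x ++ y)) (right m n) ≡ y
map-right {m} x y = trans (sym (tabulate-∘ (lookup (x ++ y)) (m ↑ʳ_)))
  (trans (tabulate-cong (lookup-++ʳ x y)) (tabulate∘lookup y))

∃ⁿ : ∀ k {n} → Formula (k ℕ.+ n) → Formula n
∃ⁿ zero    φ = φ
∃ⁿ (suc k) φ = ∃ⁿ k (∃' φ)

Sat-∃ⁿ : ∀ k {n} (φ : Formula (k ℕ.+ n)) v → Sat (∃ⁿ k φ) v ⟷ (Σ (Vec ℕ k) λ w → Sat φ (w ++ v))
Sat-∃ⁿ zero φ v = (λ s → [] , s) , (λ { ([] , s) → s })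
Sat-∃ⁿ (suc k) φ v with Sat-∃ⁿ k (∃' φ) v
... | f , g = (λ s → let (w , a , s') = f s in a ∷ w , s') , (λ { (a ∷ w , s) → g (w , a , s) })

DefRel : ∀ k l → (Vec ℕ k → Vec ℕ l → Set) → Set
DefRel k l R = Σ (Formula (k ℕ.+ l)) λ φ → ∀ x y → R x y ⟷ Sat φ (x ++ y)

DefRel-resp : ∀ {k l} {R S : Vec ℕ k → Vec ℕ l → Set} → DefRel k l R → (∀ x y → S x y ⟷ R x y) → DefRel k l S
DefRel-resp (φ , e) h = φ , λ x y → ⟷-trans (h x y) (e x y)

-- The two arguments may be read off from any places of a larger environment; the equations say what
-- is found there. Converse and composition are choices of `ρ` and `σ`.
DefRel-reindex : ∀ {k l N} {R} → (R' : DefRel k l R) (ρ : Vec (Fin N) k) (σ : Vec (Fin N) l) {x : Vec ℕ k} {y : Vec ℕ l} {v : Vec ℕ N} →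
  map (lookup v) ρ ≡ x → map (lookup v) σ ≡ y → R x y ⟷ Sat (ren (ρ ++ σ) (proj₁ R')) v
DefRel-reindex (φ , e) ρ σ {v = v} refl refl =
  ⟷-trans (e _ _)
    (subst (λ u → Sat φ u ⟷ Sat (ren (ρ ++ σ) φ) v) (map-++ (lookup v) ρ σ)
      (let (f , g) = Sat-ren φ (ρ ++ σ) v in g , f))

DefRel-converse : ∀ {k l R} → DefRel k l R → DefRel l k (λ y x → R x y)
DefRel-converse {k} {l} d = _ , λ y x →
  DefRel-reindex d (right l k) (left l k) (map-right y x) (map-left y x)

DefRel-∪ : ∀ {k l R S} → DefRel k l R → DefRel k l S → DefRel k l (λ x y → R x y ⊎ S x y)
DefRel-∪ (φ , e) (ψ , e') = (φ ∨' ψ) , λ x y →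
  (λ { (inj₁ r) → inj₁ (proj₁ (e x y) r) ; (inj₂ r) → inj₂ (proj₁ (e' x y) r) }) ,
  (λ { (inj₁ r) → inj₁ (proj₂ (e x y) r) ; (inj₂ r) → inj₂ (proj₂ (e' x y) r) })

DefRel-comp : ∀ {k l p R S} → DefRel k l R → DefRel l p S →
  DefRel k p (λ x z → Σ (Vec ℕ l) λ y → R x y × S y z)
DefRel-comp {k} {l} {p} {R} {S} d d' =
  ∃ⁿ l (ren ρ₁ (proj₁ d) ∧' ren ρ₂ (proj₁ d')) , λ x z →
    (λ (y , r , s) → proj₂ (Sat-∃ⁿ l _ (x ++ z)) (y , proj₁ (eq₁ x y z) r , proj₁ (eq₂ x y z) s)) ,
    (λ s → let (y , r , s') = proj₁ (Sat-∃ⁿ l _ (x ++ z)) s in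
           y , proj₂ (eq₁ x y z) r , proj₂ (eq₂ x y z) s')
  where
  -- The environment is `y ++ (x ++ z)`, with the quantified block in front, so the places of `x`
  -- and `z` are shifted by `l`.
  ρ₁ = map (l ↑ʳ_) (left k p) ++ left l (k ℕ.+ p)
  ρ₂ = left l (k ℕ.+ p) ++ map (l ↑ʳ_) (right k p)
  eq₁ : ∀ x y z → R x y ⟷ Sat (ren ρ₁ (proj₁ d)) (y ++ (x ++ z))
  eq₁ x y z = DefRel-reindex d (map (l ↑ʳ_) (left k p)) (left l (k ℕ.+ p))
    (trans (map-shift y (x ++ z) (left k p)) (map-left x z)) (map-left y (x ++ z))
  eq₂ : ∀ x y z → S y z ⟷ Sat (ren ρ₂ (proj₁ d')) (y ++ (x ++ z))
  eq₂ x y z = DefRel-reindex d' (left l (k ℕ.+ p)) (map (l ↑ʳ_) (right k p))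
    (map-left y (x ++ z)) (trans (map-shift y (x ++ z) (right k p)) (map-right x z))

-- Graphs are written with the value first.
DefFun : ∀ {k l} → (Vec ℕ l → Vec ℕ k) → Set
DefFun {k} {l} f = DefRel k l (λ x z → x ≡ f z)

DefFun-∘ : ∀ {k l m} {f : Vec ℕ l → Vec ℕ k} {g : Vec ℕ m → Vec ℕ l} → DefFun f → DefFun g → DefFun (f ∘ g)
DefFun-∘ {f = f} d d' = DefRel-resp (DefRel-comp d d') λ x z →
  (λ e → _ , e , refl) , (λ (y , e , e') → trans e (cong f e'))

-- The affine maps used for cutting need numerals and scalar multiples, which the parameter-free
-- language does not have as terms.
data NTerm (n : ℕ) : Set where
  var   : Fin n → NTerm n
  const : ℕ → NTerm n
  _⊞_   : NTerm n → NTerm n → NTerm n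
  _⊠_   : ℕ → NTerm n → NTerm n

evalN : ∀ {n} → NTerm n → Vec ℕ n → ℕ
evalN (var i)   v = lookup v i
evalN (const c) v = c
evalN (s ⊞ t)   v = evalN s v ℕ.+ evalN t v
evalN (c ⊠ t)   v = c ℕ.* evalN t v

-- Numerals are expanded over two extra variables, 0 and 1, meant to have these values.
unN : ∀ {n} → NTerm n → Term (2 ℕ.+ n)
unN (var i)         = var (suc (suc i))
unN (const zero)    = var zero
unN (const (suc c)) = var (suc zero) ⊕ unN (const c)
unN (s ⊞ t)         = unN s ⊕ unN t
unN (zero ⊠ t)      = var zero
unN (suc c ⊠ t)     = unN t ⊕ unN (c ⊠ t)

evalT-unN : ∀ {n} (t : NTerm n) v → evalT (unN t) (0 ∷ 1 ∷ v) ≡ evalN t v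
evalT-unN (var i) v = refl
evalT-unN (const zero) v = refl
evalT-unN (const (suc c)) v = cong suc (evalT-unN (const c) v)
evalT-unN (s ⊞ t) v = cong₂ ℕ._+_ (evalT-unN s v) (evalT-unN t v)
evalT-unN (zero ⊠ t) v = refl
evalT-unN (suc c ⊠ t) v = cong₂ ℕ._+_ (evalT-unN t v) (evalT-unN (c ⊠ t) v)

isZero : ∀ {n} → Term n → Formula n
isZero t = (t ⊕ t) ≐ t

a+a≡a⇒a≡0 : ∀ a → a ℕ.+ a ≡ a → a ≡ 0
a+a≡a⇒a≡0 zero    _ = refl
a+a≡a⇒a≡0 (suc a) e = ⊥-elim (ℕₚ.m+1+n≢m a (ℕₚ.suc-injective e))

-- 1 is the least nonzero number.
isOne : ∀ {n} → Fin n → Formula n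
isOne i = (~ isZero (var i)) ∧' ∀' (isZero (var zero) ∨' ∃' (var (suc zero) ≐ (var (suc (suc i)) ⊕ var zero)))

Sat-isOne : ∀ {n} (i : Fin n) v → lookup v i ≡ 1 ⟷ Sat (isOne i) v
Sat-isOne i v = to , from
  where
  to : lookup v i ≡ 1 → Sat (isOne i) v
  to e rewrite e = (λ ()) , λ { zero → inj₁ refl ; (suc b) → inj₂ (b , refl) }
  from : Sat (isOne i) v → lookup v i ≡ 1
  -- At the number 1 the second conjunct yields 1 = v_i + c, since 1 is not zero; hence v_i ≤ 1.
  from (nz , h) with lookup v i | h 1
  ... | _ | inj₁ ()
  ... | zero | inj₂ _ = ⊥-elim (nz refl)
  ... | suc a | inj₂ (c , e) = cong suc (ℕₚ.m+n≡0⇒m≡0 a (sym (ℕₚ.suc-injective e)))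

_≐ᴺ_ : ∀ {n} → NTerm n → NTerm n → Formula n
s ≐ᴺ t = ∃' (∃' ((isZero (var zero) ∧' isOne (suc zero)) ∧' (unN s ≐ unN t)))

Sat-≐ᴺ : ∀ {n} (s t : NTerm n) v → evalN s v ≡ evalN t v ⟷ Sat (s ≐ᴺ t) v
Sat-≐ᴺ s t v =
  (λ e → 1 , 0 , (refl , proj₁ (Sat-isOne (suc zero) (0 ∷ 1 ∷ v)) refl) ,
    trans (evalT-unN s v) (trans e (sym (evalT-unN t v)))) ,
  λ (a , b , (z , o) , e) → from a b (a+a≡a⇒a≡0 b z) (proj₂ (Sat-isOne (suc zero) (b ∷ a ∷ v)) o) e
  where
  from : ∀ a b → b ≡ 0 → a ≡ 1 → evalT (unN s) (b ∷ a ∷ v) ≡ evalT (unN t) (b ∷ a ∷ v) → evalN s v ≡ evalN t v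
  from _ _ refl refl e = trans (sym (evalT-unN s v)) (trans e (evalT-unN t v))

renN : ∀ {n N} → (Fin n → Fin N) → NTerm n → NTerm N
renN f (var i)   = var (f i)
renN f (const c) = const c
renN f (s ⊞ t)   = renN f s ⊞ renN f t
renN f (c ⊠ t)   = c ⊠ renN f t

evalN-ren : ∀ {n N} (f : Fin n → Fin N) t {u v} → (∀ i → lookup v (f i) ≡ lookup u i) → evalN (renN f t) v ≡ evalN t u
evalN-ren f (var i) h = h i
evalN-ren f (const c) h = refl
evalN-ren f (s ⊞ t) h = cong₂ ℕ._+_ (evalN-ren f s h) (evalN-ren f t h)
evalN-ren f (c ⊠ t) h = cong (c ℕ.*_) (evalN-ren f t h)

DefFun-terms : ∀ {k l} (ts : Vec (NTerm l) k) → DefFun (λ z → map (λ t → evalN t z) ts)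
-- There are no closed terms and `l` may be 0, so the true formula has to bind a variable of its
-- own.
DefFun-terms [] = ∀' (var zero ≐ var zero) , λ { [] z → (λ _ _ → refl) , (λ _ → refl) }
DefFun-terms {suc k} {l} (t ∷ ts) =
  ((var zero ≐ᴺ renN (suc k ↑ʳ_) t) ∧' ren (tabulate suc) (proj₁ IH)) ,
  λ { (a ∷ x) z →
    (λ e → proj₁ (Sat-≐ᴺ (var zero) (renN (suc k ↑ʳ_) t) ((a ∷ x) ++ z)) (trans (∷-injectiveˡ e) (sym (evalN-ren (suc k ↑ʳ_) t (lookup-++ʳ (a ∷ x) z)))) ,
           proj₂ (Sat-ren (proj₁ IH) (tabulate suc) (a ∷ (x ++ z)))
             (subst (Sat (proj₁ IH)) (sym (map-right (a ∷ []) (x ++ z))) (proj₁ (proj₂ IH x z) (∷-injectiveʳ e)))) ,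
    (λ (p , q) → cong₂ _∷_
       (trans (proj₂ (Sat-≐ᴺ (var zero) (renN (suc k ↑ʳ_) t) ((a ∷ x) ++ z)) p) (evalN-ren (suc k ↑ʳ_) t (lookup-++ʳ (a ∷ x) z)))
       (proj₂ (proj₂ IH x z) (subst (Sat (proj₁ IH)) (map-right (a ∷ []) (x ++ z))
          (proj₁ (Sat-ren (proj₁ IH) (tabulate suc) (a ∷ (x ++ z))) q)))) }
  where IH = DefFun-terms {k} {l} ts

-- Elimination of quantifiers

Form : ℕ → Set
Form n = Vec ℤ n × ℤ

dot : ∀ {n} → Vec ℤ n → Vec ℕ n → ℤ
dot []       []       = 0ℤ
dot (a ∷ as) (x ∷ xs) = a * + x + dot as xs

⟦_⟧ : ∀ {n} → Form n → Vec ℕ n → ℤ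
⟦ a , c ⟧ u = dot a u + c

_⊹_ : ∀ {n} → Form n → Form n → Form n
(a , c) ⊹ (b , d) = zipWith _+_ a b , c + d

_⋆_ : ∀ {n} → ℤ → Form n → Form n
k ⋆ (a , c) = map (k *_) a , k * c

constF : ∀ {n} → ℤ → Form n
constF c = replicate _ 0ℤ , c

unit : ∀ {n} → Fin n → Vec ℤ n
unit zero    = 1ℤ ∷ replicate _ 0ℤ
unit (suc i) = 0ℤ ∷ unit i

coordF : ∀ {n} → Fin n → Form n
coordF i = unit i , 0ℤ

dot-+ : ∀ {n} (a b : Vec ℤ n) u → dot (zipWith _+_ a b) u ≡ dot a u + dot b u
dot-+ [] [] [] = refl
dot-+ (a ∷ as) (b ∷ bs) (x ∷ u) rewrite dot-+ as bs u = lem a b (+ x) (dot as u) (dot bs u)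
  where
  lem : ∀ a b x p q → (a + b) * x + (p + q) ≡ (a * x + p) + (b * x + q)
  lem = solve-∀

dot-* : ∀ {n} k (a : Vec ℤ n) u → dot (map (k *_) a) u ≡ k * dot a u
dot-* k [] [] = sym (ℤₚ.*-zeroʳ k)
dot-* k (a ∷ as) (x ∷ u) rewrite dot-* k as u = lem k a (+ x) (dot as u)
  where
  lem : ∀ k a x p → k * a * x + k * p ≡ k * (a * x + p)
  lem = solve-∀

dot-0 : ∀ {n} (u : Vec ℕ n) → dot (replicate _ 0ℤ) u ≡ 0ℤ
dot-0 [] = refl
dot-0 (x ∷ u) = trans (ℤₚ.+-identityˡ _) (dot-0 u)

dot-unit : ∀ {n} (i : Fin n) u → dot (unit i) u ≡ + lookup u i
dot-unit zero (x ∷ u) rewrite dot-0 u = trans (ℤₚ.+-identityʳ _) (ℤₚ.*-identityˡ (+ x))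
dot-unit (suc i) (x ∷ u) = trans (ℤₚ.+-identityˡ _) (dot-unit i u)

⟦⟧-⊹ : ∀ {n} (f g : Form n) u → ⟦ f ⊹ g ⟧ u ≡ ⟦ f ⟧ u + ⟦ g ⟧ u
⟦⟧-⊹ (a , c) (b , d) u rewrite dot-+ a b u = lem (dot a u) (dot b u) c d
  where
  lem : ∀ p q c d → p + q + (c + d) ≡ p + c + (q + d)
  lem = solve-∀

⟦⟧-⋆ : ∀ {n} k (f : Form n) u → ⟦ k ⋆ f ⟧ u ≡ k * ⟦ f ⟧ u
⟦⟧-⋆ k (a , c) u rewrite dot-* k a u = sym (ℤₚ.*-distribˡ-+ k (dot a u) c)

⟦⟧-constF : ∀ {n} c (u : Vec ℕ n) → ⟦ constF c ⟧ u ≡ c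
⟦⟧-constF c u rewrite dot-0 u = ℤₚ.+-identityˡ c

⟦⟧-coordF : ∀ {n} (i : Fin n) u → ⟦ coordF i ⟧ u ≡ + lookup u i
⟦⟧-coordF i u rewrite dot-unit i u = ℤₚ.+-identityʳ _

-- Two sign classes suffice, zero counting as nonnegative: s = t is the conjunction of s - t ≥ 0 and
-- t - s ≥ 0.
nonneg : ℤ → Bool
nonneg (+ _)    = true
nonneg -[1+ _ ] = false

nonneg-⊖-≥ : ∀ {m n} → n ℕ.≤ m → nonneg (m ⊖ n) ≡ true
nonneg-⊖-≥ le rewrite ℤₚ.⊖-≥ le = refl

nonneg-⊖-< : ∀ {m n} → m ℕ.< n → nonneg (m ⊖ n) ≡ false
nonneg-⊖-< {m} {n} lt with n ℕ.∸ m | ℤₚ.⊖-< lt | ℕₚ.m<n⇒0<n∸m lt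
... | suc k | e | _ rewrite e = refl

-- Denominators are cleared with the square of a leading coefficient, which spares a case
-- distinction on its sign.
nonneg-square-* : ∀ k z → k ≢ 0ℤ → nonneg (k * k * z) ≡ nonneg z
nonneg-square-* (+ zero)  z        k≢0 = ⊥-elim (k≢0 refl)
nonneg-square-* (+ suc k) (+ z)    _   = sym (cong nonneg (ℤₚ.pos-* (suc k ℕ.* suc k) z))
nonneg-square-* (+ suc k) -[1+ z ] _   = refl
nonneg-square-* -[1+ k ]  (+ z)    _   = sym (cong nonneg (ℤₚ.pos-* (suc k ℕ.* suc k) z))
nonneg-square-* -[1+ k ]  -[1+ z ] _   = refl

nonneg⇒+ : ∀ z → nonneg z ≡ true → Σ ℕ λ n → z ≡ + n
nonneg⇒+ (+ n) _ = n , refl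

-- When adding `e` crosses the border between negative and nonnegative, the end point lies between 0
-- and `e`.
sign-change : ∀ p e → nonneg (p + e) ≢ nonneg p → ∣ p + e ∣ ℕ.≤ ∣ e ∣
sign-change (+ m) (+ n) ne = ⊥-elim (ne refl)
sign-change (+ m) -[1+ n ] ne with suc n ℕ.≤? m
... | yes le = ⊥-elim (ne (nonneg-⊖-≥ le))
... | no  gt rewrite ℤₚ.⊖-< (ℕₚ.≰⇒> gt) | ℤₚ.∣-i∣≡∣i∣ (+ (suc n ℕ.∸ m)) = ℕₚ.m∸n≤m (suc n) m
sign-change -[1+ m ] (+ n) ne with suc m ℕ.≤? n
... | yes le rewrite ℤₚ.⊖-≥ le = ℕₚ.m∸n≤m n (suc m)
... | no  gt = ⊥-elim (ne (nonneg-⊖-< (ℕₚ.≰⇒> gt)))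
sign-change -[1+ m ] -[1+ n ] ne = ⊥-elim (ne refl)

-- Sets determined by signs and residues

Cong : ℕ → ℤ → ℤ → Set
Cong D x y = Σ ℤ λ q → x ≡ y + q * + D

CongV : ∀ {n} → ℕ → Vec ℕ n → Vec ℕ n → Set
CongV D u v = ∀ i → Cong D (+ lookup u i) (+ lookup v i)

Cong-refl : ∀ {D} x → Cong D x x
Cong-refl x = 0ℤ , sym (ℤₚ.+-identityʳ x)

Cong-sym : ∀ {D x y} → Cong D x y → Cong D y x
Cong-sym {D} {x} {y} (q , e) = - q , trans (lem y q (+ D)) (cong (_+ - q * + D) (sym e))
  where
  lem : ∀ y q d → y ≡ y + q * d + - q * d
  lem = solve-∀

Cong-∣ : ∀ {D D' x y} → D ℕ∣.∣ D' → Cong D' x y → Cong D x y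
Cong-∣ {D} {D'} {y = y} (ℕ∣.divides k refl) (q , e) = q * + k ,
  trans e (cong (_+_ y) (trans (cong (q *_) (ℤₚ.pos-* k D)) (sym (ℤₚ.*-assoc q (+ k) (+ D)))))

Cong-dot : ∀ {n D} (a : Vec ℤ n) {u v} → CongV D u v → Cong D (dot a u) (dot a v)
Cong-dot [] {[]} {[]} h = Cong-refl 0ℤ
Cong-dot {D = D} (a ∷ as) {x ∷ u} {y ∷ v} h with h zero | Cong-dot as {u} {v} (h ∘ suc)
... | q , e | r , e' = a * q + r , trans (cong₂ (λ s t → a * s + t) e e') (lem a (+ y) (dot as v) q r (+ D))
  where
  lem : ∀ a y p q r d → a * (y + q * d) + (p + r * d) ≡ a * y + p + (a * q + r) * d
  lem = solve-∀

Cong-⟦⟧ : ∀ {n D} (f : Form n) {u v} → CongV D u v → Cong D (⟦ f ⟧ u) (⟦ f ⟧ v)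
Cong-⟦⟧ {D = D} (a , c) {u} {v} h with Cong-dot a h
... | q , e = q , trans (cong (_+ c) e) (lem (dot a v) c (q * + D))
  where
  lem : ∀ p c t → p + t + c ≡ p + c + t
  lem = solve-∀

Same : ∀ {n} → Vec ℕ n → Vec ℕ n → Form n → Set
Same u v f = nonneg (⟦ f ⟧ u) ≡ nonneg (⟦ f ⟧ v)

-- A semantic substitute for a quantifier-free formula: no Boolean combination of atoms is ever
-- written down. One implication is enough because the hypotheses are symmetric in `u` and `v`.
Determined : ∀ {n} → List (Form n) → ℕ → (Vec ℕ n → Set) → Set
Determined F D X = ∀ u v → All (Same u v) F → CongV D u v → X u → X v

-- `decide` is what makes ∀ equivalent to ¬∃¬ here, and later tells whether a piece on which the set
-- is constant is full or empty.
record Presburger {n} (X : Vec ℕ n → Set) : Set where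
  constructor presburger
  field
    forms      : List (Form n)
    modulus    : ℕ
    modulus≢0  : NonZero modulus
    determined : Determined forms modulus X
    decide     : ∀ u → Dec (X u)

module Projection {n} (X : Vec ℕ (suc n) → Set) (P : Presburger X) where
  open Presburger P renaming (modulus to D)

  hd : Form (suc n) → ℤ
  hd (a ∷ _ , _) = a

  tl : Form (suc n) → Form n
  tl (_ ∷ as , c) = as , c

  ⟦⟧-∷ : ∀ f x y → ⟦ f ⟧ (x ∷ y) ≡ hd f * + x + ⟦ tl f ⟧ y
  ⟦⟧-∷ (a ∷ as , c) x y = ℤₚ.+-assoc (a * + x) (dot as y) c

  -- The coordinate form makes the non-negativity of a witness one more sign condition.
  F⁺ : List (Form (suc n))
  F⁺ = coordF zero ∷ forms

  -- Cooper's test points: dividing by the leading coefficient, `x` is within distance D of the root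
  -- of some form in F⁺.
  Critical : ℕ → Vec ℕ n → Set
  Critical x y = Σ (Form (suc n)) λ f → f ∈ F⁺ × hd f ≢ 0ℤ × ∣ ⟦ f ⟧ (x ∷ y) ∣ ℕ.≤ ∣ hd f ∣ ℕ.* D

  ⟦⟧-shift : ∀ f x y → ⟦ f ⟧ (x ℕ.+ D ∷ y) ≡ ⟦ f ⟧ (x ∷ y) + hd f * + D
  ⟦⟧-shift f x y = trans (⟦⟧-∷ f (x ℕ.+ D) y) (trans (lem (hd f) (+ x) (+ D) (⟦ tl f ⟧ y))
    (cong (_+ hd f * + D) (sym (⟦⟧-∷ f x y))))
    where
    lem : ∀ a x d t → a * (x + d) + t ≡ a * x + t + a * d
    lem = solve-∀

  -- Descending in steps of D, a witness survives until some form changes sign.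
  descend : ∀ x y → Acc ℕ._<_ x → X (x ∷ y) → Σ ℕ λ x' → X (x' ∷ y) × Critical x' y
  descend x y (acc rs) Xx with D ℕ.≤? x
  -- Below D no further step is possible, but then `x` itself, being the value of the coordinate
  -- form, is at most 1 · D.
  ... | no D≰x = x , Xx , coordF zero , here refl , (λ ()) , le
    where
    le : ∣ ⟦ coordF zero ⟧ (x ∷ y) ∣ ℕ.≤ 1 ℕ.* D
    le rewrite ⟦⟧-coordF zero (x ∷ y) | ℕₚ.*-identityˡ D = ℕₚ.<⇒≤ (ℕₚ.≰⇒> D≰x)
  ... | yes D≤x = go (x ℕ.∸ D) (ℕₚ.m∸n+n≡m D≤x)
    where
    go : ∀ x' → x' ℕ.+ D ≡ x → Σ ℕ λ x' → X (x' ∷ y) × Critical x' y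
    go x' refl with all? (λ f → nonneg (⟦ f ⟧ (x' ℕ.+ D ∷ y)) Boolₚ.≟ nonneg (⟦ f ⟧ (x' ∷ y))) forms
    ... | yes same = descend x' y (rs (ℕₚ.m<m+n x' (ℕ.>-nonZero⁻¹ D {{modulus≢0}}))) (determined (x' ℕ.+ D ∷ y) (x' ∷ y) same cg Xx)
      where
      cg : CongV D (x' ℕ.+ D ∷ y) (x' ∷ y)
      cg zero    = 1ℤ , cong (_+_ (+ x')) (sym (ℤₚ.*-identityˡ (+ D)))
      cg (suc i) = Cong-refl _
    ... | no ¬same with find (Allₚ.¬All⇒Any¬ (λ f → nonneg (⟦ f ⟧ (x' ℕ.+ D ∷ y)) Boolₚ.≟ nonneg (⟦ f ⟧ (x' ∷ y))) forms ¬same)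
    ... | f , f∈ , ne = x' ℕ.+ D , Xx , f , there f∈ , a≢0 , le
      where
      a≢0 : hd f ≢ 0ℤ
      a≢0 e = ne (cong nonneg (trans (⟦⟧-shift f x' y)
        (trans (cong (λ a → ⟦ f ⟧ (x' ∷ y) + a * + D) e) (ℤₚ.+-identityʳ _))))
      le : ∣ ⟦ f ⟧ (x' ℕ.+ D ∷ y) ∣ ℕ.≤ ∣ hd f ∣ ℕ.* D
      le = subst₂ ℕ._≤_ (cong ∣_∣ (sym (⟦⟧-shift f x' y))) (ℤₚ.abs-* (hd f) (+ D))
             (sign-change (⟦ f ⟧ (x' ∷ y)) (hd f * + D) (ne ∘ trans (cong nonneg (⟦⟧-shift f x' y))))

  critical : ∀ x y → X (x ∷ y) → Σ ℕ λ x' → X (x' ∷ y) × Critical x' y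
  critical x y = descend x y (<-wellFounded x)

  norm : ∀ {m} → Form m → ℕ
  norm ([] , c)     = ∣ c ∣
  norm (a ∷ as , c) = ∣ a ∣ ℕ.+ norm (as , c)

  ∣⟦⟧∣≤ : ∀ {m} (f : Form m) y → ∣ ⟦ f ⟧ y ∣ ℕ.≤ norm f ℕ.* suc (Vec.sum y)
  ∣⟦⟧∣≤ ([] , c) [] rewrite ℤₚ.+-identityˡ c = ℕₚ.≤-reflexive (sym (ℕₚ.*-identityʳ ∣ c ∣))
  ∣⟦⟧∣≤ (a ∷ as , c) (x ∷ y) = begin
    ∣ a * + x + dot as y + c ∣                  ≡⟨ cong ∣_∣ (ℤₚ.+-assoc (a * + x) (dot as y) c) ⟩
    ∣ a * + x + ⟦ as , c ⟧ y ∣                  ≤⟨ ℤₚ.∣i+j∣≤∣i∣+∣j∣ (a * + x) (⟦ as , c ⟧ y) ⟩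
    ∣ a * + x ∣ ℕ.+ ∣ ⟦ as , c ⟧ y ∣            ≡⟨ cong (ℕ._+ ∣ ⟦ as , c ⟧ y ∣) (ℤₚ.abs-* a (+ x)) ⟩
    ∣ a ∣ ℕ.* x ℕ.+ ∣ ⟦ as , c ⟧ y ∣            ≤⟨ ℕₚ.+-mono-≤ (ℕₚ.*-monoʳ-≤ ∣ a ∣ (ℕₚ.≤-trans (ℕₚ.m≤m+n x _) (ℕₚ.n≤1+n _)))
                                                   (ℕₚ.≤-trans (∣⟦⟧∣≤ (as , c) y) (ℕₚ.*-monoʳ-≤ (norm (as , c)) (s≤s (ℕₚ.m≤n+m _ x)))) ⟩
    ∣ a ∣ ℕ.* S ℕ.+ norm (as , c) ℕ.* S         ≡⟨ sym (ℕₚ.*-distribʳ-+ S ∣ a ∣ (norm (as , c))) ⟩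
    (∣ a ∣ ℕ.+ norm (as , c)) ℕ.* S             ∎
    where
    open ℕₚ.≤-Reasoning
    S = suc (x ℕ.+ Vec.sum y)

  weight : Form (suc n) → ℕ
  weight f = ∣ hd f ∣ ℕ.* D ℕ.+ norm (tl f)

  bound : ℕ
  bound = sum (List.map weight F⁺)

  weight≤ : ∀ {f} F → f ∈ F → weight f ℕ.≤ sum (List.map weight F)
  weight≤ (f ∷ F) (here refl) = ℕₚ.m≤m+n _ _
  weight≤ (g ∷ F) (there f∈)  = ℕₚ.≤-trans (weight≤ F f∈) (ℕₚ.m≤n+m _ (weight g))

  -- The leading coefficient a is a nonzero integer, so x ≤ |a x| = |f(x, y) - t(y)| with t the rest
  -- of f. The first term is small at a critical point and the second is linear in y.
  Critical⇒≤ : ∀ x y → Critical x y → x ℕ.≤ bound ℕ.* suc (Vec.sum y)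
  Critical⇒≤ x y (f , f∈ , a≢0 , le) = begin
    x                                                ≤⟨ ℕₚ.m≤n*m x ∣ hd f ∣ {{ℕ.≢-nonZero (a≢0 ∘ ℤₚ.∣i∣≡0⇒i≡0)}} ⟩
    ∣ hd f ∣ ℕ.* x                                   ≡⟨ sym (ℤₚ.abs-* (hd f) (+ x)) ⟩
    ∣ hd f * + x ∣                                   ≡⟨ cong ∣_∣ (trans (lem (hd f * + x) (⟦ tl f ⟧ y)) (cong (_- ⟦ tl f ⟧ y) (sym (⟦⟧-∷ f x y)))) ⟩
    ∣ ⟦ f ⟧ (x ∷ y) - ⟦ tl f ⟧ y ∣                   ≤⟨ ℤₚ.∣i-j∣≤∣i∣+∣j∣ (⟦ f ⟧ (x ∷ y)) (⟦ tl f ⟧ y) ⟩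
    ∣ ⟦ f ⟧ (x ∷ y) ∣ ℕ.+ ∣ ⟦ tl f ⟧ y ∣             ≤⟨ ℕₚ.+-mono-≤ (ℕₚ.≤-trans le (ℕₚ.m≤m*n _ S)) (∣⟦⟧∣≤ (tl f) y) ⟩
    ∣ hd f ∣ ℕ.* D ℕ.* S ℕ.+ norm (tl f) ℕ.* S       ≡⟨ sym (ℕₚ.*-distribʳ-+ S (∣ hd f ∣ ℕ.* D) (norm (tl f))) ⟩
    weight f ℕ.* S                                   ≤⟨ ℕₚ.*-monoˡ-≤ S (weight≤ F⁺ f∈) ⟩
    bound ℕ.* S                                      ∎
    where
    open ℕₚ.≤-Reasoning
    S = suc (Vec.sum y)
    lem : ∀ p t → p ≡ p + t - t
    lem = solve-∀

  -- Used twice: it reduces the decision of ∃ to a finite search, and it is the source of the linear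
  -- growth of definable functions.
  bounded-witness : ∀ x y → X (x ∷ y) → Σ ℕ λ x' → X (x' ∷ y) × x' ℕ.≤ bound ℕ.* suc (Vec.sum y)
  bounded-witness x y Xx = let (x' , Xx' , cr) = critical x y Xx in x' , Xx' , Critical⇒≤ x' y cr

  decide∃ : ∀ y → Dec (Σ ℕ λ x → X (x ∷ y))
  decide∃ y = map′ (λ (x , _ , Xx) → x , Xx)
    (λ (x , Xx) → let (x' , Xx' , le) = bounded-witness x y Xx in x' , s≤s le , Xx')
    (ℕₚ.anyUpTo? (λ x → decide (x ∷ y)) (suc (bound ℕ.* suc (Vec.sum y))))

  -- If f(x, y) = s, the value at y of cross f s g is (hd f)² g(x, y).
  cross : Form (suc n) → ℤ → Form (suc n) → Form n
  cross f s g = hd f ⋆ ((hd g ⋆ (constF s ⊹ (-1ℤ ⋆ tl f))) ⊹ (hd f ⋆ tl g))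

  -- Here `x` is an integer, because the identity is also needed at a transported witness before
  -- that is known to be nonnegative.
  ⟦cross⟧ : ∀ f s g x y → hd f * x + ⟦ tl f ⟧ y ≡ s →
    ⟦ cross f s g ⟧ y ≡ hd f * hd f * (hd g * x + ⟦ tl g ⟧ y)
  ⟦cross⟧ f s g x y refl = begin
    ⟦ hd f ⋆ ((hd g ⋆ (constF s ⊹ (-1ℤ ⋆ tl f))) ⊹ (hd f ⋆ tl g)) ⟧ y
      ≡⟨ ⟦⟧-⋆ (hd f) ((hd g ⋆ (constF s ⊹ (-1ℤ ⋆ tl f))) ⊹ (hd f ⋆ tl g)) y ⟩
    hd f * ⟦ (hd g ⋆ (constF s ⊹ (-1ℤ ⋆ tl f))) ⊹ (hd f ⋆ tl g) ⟧ y
      ≡⟨ cong (hd f *_) (⟦⟧-⊹ (hd g ⋆ (constF s ⊹ (-1ℤ ⋆ tl f))) (hd f ⋆ tl g) y) ⟩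
    hd f * (⟦ hd g ⋆ (constF s ⊹ (-1ℤ ⋆ tl f)) ⟧ y + ⟦ hd f ⋆ tl g ⟧ y)
      ≡⟨ cong₂ (λ p q → hd f * (p + q)) (⟦⟧-⋆ (hd g) (constF s ⊹ (-1ℤ ⋆ tl f)) y) (⟦⟧-⋆ (hd f) (tl g) y) ⟩
    hd f * (hd g * ⟦ constF s ⊹ (-1ℤ ⋆ tl f) ⟧ y + hd f * ⟦ tl g ⟧ y)
      ≡⟨ cong (λ p → hd f * (hd g * p + hd f * ⟦ tl g ⟧ y)) (trans (⟦⟧-⊹ (constF s) (-1ℤ ⋆ tl f) y)
           (cong₂ _+_ (⟦⟧-constF s y) (⟦⟧-⋆ -1ℤ (tl f) y))) ⟩
    hd f * (hd g * (hd f * x + ⟦ tl f ⟧ y + -1ℤ * ⟦ tl f ⟧ y) + hd f * ⟦ tl g ⟧ y)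
      ≡⟨ lem (hd f) (hd g) x (⟦ tl f ⟧ y) (⟦ tl g ⟧ y) ⟩
    hd f * hd f * (hd g * x + ⟦ tl g ⟧ y) ∎
    where
    open ≡-Reasoning
    lem : ∀ a b x t u → a * (b * (a * x + t + -1ℤ * t) + a * u) ≡ a * a * (b * x + u)
    lem = solve-∀

  range : ℕ → List ℤ
  range N = List.map +_ (upTo (suc N)) List.++ List.map (λ n → - (+ n)) (upTo (suc N))

  ∈-range : ∀ N s → ∣ s ∣ ℕ.≤ N → s ∈ range N
  ∈-range N (+ n)    le = ∈-++⁺ˡ (∈-map⁺ +_ (∈-upTo⁺ (s≤s le)))
  ∈-range N -[1+ n ] le = ∈-++⁺ʳ (List.map +_ (upTo (suc N))) (∈-map⁺ (λ n → - (+ n)) (∈-upTo⁺ (s≤s le)))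

  F∃ : List (Form n)
  F∃ = concatMap (λ f → concatMap (λ s → List.map (cross f s) F⁺) (range (∣ hd f ∣ ℕ.* D))) F⁺

  ∈-F∃ : ∀ {f g s} → f ∈ F⁺ → g ∈ F⁺ → ∣ s ∣ ℕ.≤ ∣ hd f ∣ ℕ.* D → cross f s g ∈ F∃
  ∈-F∃ {f} {g} {s} f∈ g∈ le =
    ∈-concatMap⁺ (λ f → concatMap (λ s → List.map (cross f s) F⁺) (range (∣ hd f ∣ ℕ.* D)))
      (lose f∈ (∈-concatMap⁺ (λ s → List.map (cross f s) F⁺) (lose (∈-range _ s le) (∈-map⁺ (cross f s) g∈))))

  positive : ℕ → ℕ
  positive zero    = 1
  positive (suc a) = suc a

  -- A common multiple of the nonzero leading coefficients; a vanishing one counts as 1, so that the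
  -- product stays nonzero.
  heads : List (Form (suc n)) → ℕ
  heads []      = 1
  heads (f ∷ F) = positive ∣ hd f ∣ ℕ.* heads F

  heads≢0 : ∀ F → NonZero (heads F)
  heads≢0 []      = _
  heads≢0 (f ∷ F) = ℕₚ.m*n≢0 (positive ∣ hd f ∣) (heads F) {{pos ∣ hd f ∣}} {{heads≢0 F}}
    where
    pos : ∀ a → NonZero (positive a)
    pos zero    = _
    pos (suc a) = _

  ∣heads : ∀ {f} F → f ∈ F → hd f ≢ 0ℤ → ∣ hd f ∣ ℕ∣.∣ heads F
  ∣heads {f} (f ∷ F) (here refl) a≢0 = subst (ℕ∣._∣ heads (f ∷ F)) (eq ∣ hd f ∣ (a≢0 ∘ ℤₚ.∣i∣≡0⇒i≡0)) (ℕ∣.m∣m*n (heads F))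
    where
    eq : ∀ a → a ≢ 0 → positive a ≡ a
    eq zero    ne = ⊥-elim (ne refl)
    eq (suc a) ne = refl
  ∣heads (g ∷ F) (there f∈) a≢0 = ℕ∣.∣n⇒∣m*n (positive ∣ hd g ∣) (∣heads F f∈ a≢0)

  -- If y and y' agree modulo this number, the rest of a form with leading coefficient a ≠ 0 changes
  -- by a multiple of a D, which a shift of the witness by a multiple of D can compensate.
  D∃ : ℕ
  D∃ = heads F⁺ ℕ.* D

  -- A critical witness for `y`, located by f = s, is moved to the point over `y'` where f still
  -- equals s. The forms `cross f s g` see the sign of every g at that point, and its residue modulo
  -- D has not changed.
  determined∃ : Determined F∃ D∃ (λ y → Σ ℕ λ x → X (x ∷ y))
  determined∃ y y' same cg (x₀ , Xx₀) with critical x₀ y Xx₀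
  ... | x , Xx , f , f∈ , a≢0 , le with ℤ∣.∣ᵤ⇒∣ {hd f} {+ heads F⁺} (∣heads F⁺ f∈ a≢0) | Cong-⟦⟧ (tl f) cg
  ... | ℤ∣.divides k ek | q , eq = go (nonneg⇒+ x' x'-def)
    where
    s = ⟦ f ⟧ (x ∷ y)
    x' : ℤ
    -- The solution of hd f · x' + tl f (y') = s: the rest of f differs by q · D∃ = q · k · hd f · D
    -- between `y` and `y'`.
    x' = + x + q * k * + D
    eD : + D∃ ≡ k * hd f * + D
    eD = trans (ℤₚ.pos-* (heads F⁺) D) (cong (_* + D) ek)
    fx' : hd f * x' + ⟦ tl f ⟧ y' ≡ s
    fx' = trans (lem (hd f) (+ x) q k (+ D) (⟦ tl f ⟧ y'))
      (trans (cong (_+_ (hd f * + x)) (trans (cong (λ d → ⟦ tl f ⟧ y' + q * d) (sym eD)) (sym eq))) (sym (⟦⟧-∷ f x y)))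
      where
      lem : ∀ a x q k d t → a * (x + q * k * d) + t ≡ a * x + (t + q * (k * a * d))
      lem = solve-∀
    sign : ∀ g → g ∈ F⁺ → nonneg (⟦ g ⟧ (x ∷ y)) ≡ nonneg (hd g * x' + ⟦ tl g ⟧ y')
    sign g g∈ = begin
      nonneg (⟦ g ⟧ (x ∷ y))                                ≡⟨ cong nonneg (⟦⟧-∷ g x y) ⟩
      nonneg (hd g * + x + ⟦ tl g ⟧ y)                      ≡⟨ sym (nonneg-square-* (hd f) _ a≢0) ⟩
      nonneg (hd f * hd f * (hd g * + x + ⟦ tl g ⟧ y))      ≡⟨ cong nonneg (sym (⟦cross⟧ f s g (+ x) y (sym (⟦⟧-∷ f x y)))) ⟩
      nonneg (⟦ cross f s g ⟧ y)                            ≡⟨ All.lookup same (∈-F∃ {s = s} f∈ g∈ le) ⟩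
      nonneg (⟦ cross f s g ⟧ y')                           ≡⟨ cong nonneg (⟦cross⟧ f s g x' y' fx') ⟩
      nonneg (hd f * hd f * (hd g * x' + ⟦ tl g ⟧ y'))      ≡⟨ nonneg-square-* (hd f) _ a≢0 ⟩
      nonneg (hd g * x' + ⟦ tl g ⟧ y')                      ∎
      where open ≡-Reasoning
    x'-def : nonneg x' ≡ true
    x'-def = trans (cong nonneg (sym x'≡)) (trans (sym (sign (coordF zero) (here refl))) (cong nonneg (⟦⟧-coordF zero (x ∷ y))))
      where
      x'≡ : 1ℤ * x' + ⟦ constF 0ℤ ⟧ y' ≡ x'
      x'≡ = trans (cong₂ _+_ (ℤₚ.*-identityˡ x') (⟦⟧-constF 0ℤ y')) (ℤₚ.+-identityʳ x')
    go : (Σ ℕ λ n → x' ≡ + n) → Σ ℕ λ x → X (x ∷ y')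
    go (n , e) = n , determined (x ∷ y) (n ∷ y') (All.tabulate same') cg' Xx
      where
      same' : ∀ {g} → g ∈ forms → Same (x ∷ y) (n ∷ y') g
      same' {g} g∈ = trans (sign g (there g∈))
        (cong nonneg (trans (cong (λ z → hd g * z + ⟦ tl g ⟧ y') e) (sym (⟦⟧-∷ g n y'))))
      cg' : CongV D (x ∷ y) (n ∷ y')
      cg' zero    = Cong-sym (q * k , sym e)
      cg' (suc i) = Cong-∣ {x = + lookup y i} {+ lookup y' i} (ℕ∣.n∣m*n (heads F⁺)) (cg i)

  projection : Presburger (λ y → Σ ℕ λ x → X (x ∷ y))
  projection = presburger F∃ D∃ (ℕₚ.m*n≢0 (heads F⁺) D {{heads≢0 F⁺}} {{modulus≢0}}) determined∃ decide∃

-- Closure under the connectives, and the atomic formulas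

Presburger-resp : ∀ {n} {X Y : Vec ℕ n → Set} → (∀ u → X u ⟷ Y u) → Presburger X → Presburger Y
Presburger-resp h (presburger F D D≢0 det dec) = presburger F D D≢0
  (λ u v s c Yu → proj₁ (h v) (det u v s c (proj₂ (h u) Yu)))
  (λ u → map′ (proj₁ (h u)) (proj₂ (h u)) (dec u))

Presburger-¬ : ∀ {n} {X : Vec ℕ n → Set} → Presburger X → Presburger (λ u → ¬ X u)
Presburger-¬ (presburger F D D≢0 det dec) = presburger F D D≢0
  (λ u v s c ¬Xu Xv → ¬Xu (det v u (All.map sym s) (λ i → Cong-sym (c i)) Xv))
  (λ u → ¬? (dec u))

module _ {n} {X Y : Vec ℕ n → Set} (P : Presburger X) (Q : Presburger Y) where
  private
    module P = Presburger P
    module Q = Presburger Q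

    both≢0 : NonZero (P.modulus ℕ.* Q.modulus)
    both≢0 = ℕₚ.m*n≢0 P.modulus Q.modulus {{P.modulus≢0}} {{Q.modulus≢0}}

    det₁ : Determined (P.forms List.++ Q.forms) (P.modulus ℕ.* Q.modulus) X
    det₁ u v s c = P.determined u v (Allₚ.++⁻ˡ P.forms s)
      (λ i → Cong-∣ {x = + lookup u i} {+ lookup v i} (ℕ∣.m∣m*n Q.modulus) (c i))

    det₂ : Determined (P.forms List.++ Q.forms) (P.modulus ℕ.* Q.modulus) Y
    det₂ u v s c = Q.determined u v (Allₚ.++⁻ʳ P.forms s)
      (λ i → Cong-∣ {x = + lookup u i} {+ lookup v i} (ℕ∣.n∣m*n P.modulus) (c i))

  Presburger-× : Presburger (λ u → X u × Y u)
  Presburger-× = presburger _ _ both≢0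
    (λ u v s c (Xu , Yu) → det₁ u v s c Xu , det₂ u v s c Yu)
    (λ u → P.decide u ×-dec Q.decide u)

  Presburger-⊎ : Presburger (λ u → X u ⊎ Y u)
  Presburger-⊎ = presburger _ _ both≢0
    (λ { u v s c (inj₁ Xu) → inj₁ (det₁ u v s c Xu) ; u v s c (inj₂ Yu) → inj₂ (det₂ u v s c Yu) })
    (λ u → P.decide u ⊎-dec Q.decide u)

termF : ∀ {n} → Term n → Form n
termF (var i) = coordF i
termF (s ⊕ t) = termF s ⊹ termF t

⟦termF⟧ : ∀ {n} (t : Term n) u → ⟦ termF t ⟧ u ≡ + evalT t u
⟦termF⟧ (var i) u = ⟦⟧-coordF i u
⟦termF⟧ (s ⊕ t) u = trans (⟦⟧-⊹ (termF s) (termF t) u)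
  (trans (cong₂ _+_ (⟦termF⟧ s u) (⟦termF⟧ t u)) (sym (ℤₚ.pos-+ (evalT s u) (evalT t u))))

Presburger-≐ : ∀ {n} (s t : Term n) → Presburger (Sat (s ≐ t))
Presburger-≐ {n} s t = presburger (ge s t ∷ ge t s ∷ []) 1 _
  (λ { u v (p ∷ q ∷ []) _ e → ℕₚ.≤-antisym
    (ge⇒≤ t s v (trans (sym q) (≤⇒ge t s u (ℕₚ.≤-reflexive e))))
    (ge⇒≤ s t v (trans (sym p) (≤⇒ge s t u (ℕₚ.≤-reflexive (sym e))))) })
  (λ u → evalT s u ℕₚ.≟ evalT t u)
  where
  ge : Term n → Term n → Form n
  ge s t = termF s ⊹ (-1ℤ ⋆ termF t)
  ⟦ge⟧ : ∀ s t u → ⟦ ge s t ⟧ u ≡ evalT s u ⊖ evalT t u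
  ⟦ge⟧ s t u = trans (⟦⟧-⊹ (termF s) (-1ℤ ⋆ termF t) u)
    (trans (cong₂ _+_ (⟦termF⟧ s u) (trans (⟦⟧-⋆ -1ℤ (termF t) u) (trans (cong (-1ℤ *_) (⟦termF⟧ t u)) (ℤₚ.-1*i≡-i _))))
           (ℤₚ.m-n≡m⊖n (evalT s u) (evalT t u)))
  ≤⇒ge : ∀ s t u → evalT t u ℕ.≤ evalT s u → nonneg (⟦ ge s t ⟧ u) ≡ true
  ≤⇒ge s t u le = trans (cong nonneg (⟦ge⟧ s t u)) (nonneg-⊖-≥ le)
  ge⇒≤ : ∀ s t u → nonneg (⟦ ge s t ⟧ u) ≡ true → evalT t u ℕ.≤ evalT s u
  ge⇒≤ s t u e with evalT t u ℕ.≤? evalT s u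
  ... | yes le = le
  ... | no  gt with trans (sym e) (trans (cong nonneg (⟦ge⟧ s t u)) (nonneg-⊖-< (ℕₚ.≰⇒> gt)))
  ... | ()

Sat-Presburger : ∀ {n} (φ : Formula n) → Presburger (Sat φ)
Sat-Presburger (s ≐ t)  = Presburger-≐ s t
Sat-Presburger (~ φ)    = Presburger-¬ (Sat-Presburger φ)
Sat-Presburger (φ ∧' ψ) = Presburger-× (Sat-Presburger φ) (Sat-Presburger ψ)
Sat-Presburger (φ ∨' ψ) = Presburger-⊎ (Sat-Presburger φ) (Sat-Presburger ψ)
Sat-Presburger (∃' φ)   = Projection.projection (Sat φ) (Sat-Presburger φ)
Sat-Presburger (∀' φ)   = Presburger-resp
  (λ u → (λ ¬∃¬ a → decidable-stable (Presburger.decide P (a ∷ u)) (λ ¬φ → ¬∃¬ (a , ¬φ))) ,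
         (λ h (a , ¬φ) → ¬φ (h a)))
  (Presburger-¬ (Projection.projection (λ v → ¬ Sat φ v) (Presburger-¬ P)))
  where P = Sat-Presburger φ

-- Growth of definable bijections

-- The tail of the vector is bounded first, for the formula that quantifies the head away; the head
-- is then bounded linearly in the tail and `y`.
linear-growth : ∀ k {l} (φ : Formula (k ℕ.+ l)) → Σ ℕ λ C → ∀ y x → Sat φ (x ++ y) →
  Σ (Vec ℕ k) λ x' → Sat φ (x' ++ y) × Vec.sum x' ≤ C ℕ.* suc (Vec.sum y)
linear-growth zero φ = 0 , λ { y [] s → [] , s , z≤n }
linear-growth (suc k) φ with linear-growth k (∃' φ)
-- With S = 1 + Σy, the tail has sum at most C S, hence the head is at most B (C S + S); the
-- constant adds up the two.
... | C , h = B ℕ.* (C ℕ.+ 1) ℕ.+ C , λ { y (a ∷ x) s → step y (h y x (a , s)) }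
  where
  open Projection (Sat φ) (Sat-Presburger φ) using (bounded-witness) renaming (bound to B)
  step : ∀ y → (Σ (Vec ℕ k) λ x → (Σ ℕ λ a → Sat φ (a ∷ (x ++ y))) × Vec.sum x ≤ C ℕ.* suc (Vec.sum y)) →
    Σ (Vec ℕ (suc k)) λ x → Sat φ (x ++ y) × Vec.sum x ≤ (B ℕ.* (C ℕ.+ 1) ℕ.+ C) ℕ.* suc (Vec.sum y)
  step y (x , (a , s) , le) with bounded-witness a (x ++ y) s
  ... | a' , s' , le' = a' ∷ x , s' , (begin
    a' ℕ.+ Vec.sum x                              ≤⟨ ℕₚ.+-monoˡ-≤ (Vec.sum x) le' ⟩
    B ℕ.* suc (Vec.sum (x ++ y)) ℕ.+ Vec.sum x ≡⟨ cong (λ z → B ℕ.* suc z ℕ.+ Vec.sum x) (sum-++ x) ⟩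
    B ℕ.* suc (Vec.sum x ℕ.+ Vec.sum y) ℕ.+ Vec.sum x
      ≤⟨ ℕₚ.+-mono-≤ (ℕₚ.*-monoʳ-≤ B (s≤s (ℕₚ.+-monoˡ-≤ (Vec.sum y) le))) le ⟩
    B ℕ.* suc (C ℕ.* suc (Vec.sum y) ℕ.+ Vec.sum y) ℕ.+ C ℕ.* suc (Vec.sum y)
      ≡⟨ lem B C (Vec.sum y) ⟩
    (B ℕ.* (C ℕ.+ 1) ℕ.+ C) ℕ.* suc (Vec.sum y)         ∎)
    where
    open ℕₚ.≤-Reasoning
    lem : ∀ B C s → B ℕ.* suc (C ℕ.* suc s ℕ.+ s) ℕ.+ C ℕ.* suc s ≡ (B ℕ.* (C ℕ.+ 1) ℕ.+ C) ℕ.* suc s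
    lem = solveℕ-∀

-- Counting points in boxes

lookup≤sum : ∀ {n} (x : Vec ℕ n) i → lookup x i ≤ Vec.sum x
lookup≤sum (a ∷ x) zero    = ℕₚ.m≤m+n a _
lookup≤sum (a ∷ x) (suc i) = ℕₚ.≤-trans (lookup≤sum x i) (ℕₚ.m≤n+m _ a)

sum-tabulate≤ : ∀ {n N} (f : Fin n → ℕ) → (∀ i → f i ≤ N) → Vec.sum (tabulate f) ≤ n ℕ.* N
sum-tabulate≤ {zero}  f h = z≤n
sum-tabulate≤ {suc n} f h = ℕₚ.+-mono-≤ (h zero) (sum-tabulate≤ (f ∘ suc) (h ∘ suc))

lookup-injective : ∀ {n} (x y : Vec ℕ n) → lookup x ≗ lookup y → x ≡ y
lookup-injective x y h = trans (sym (tabulate∘lookup x)) (trans (tabulate-cong h) (tabulate∘lookup y))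

funToFin-cong : ∀ {m n} {f g : Fin m → Fin n} → f ≗ g → funToFin f ≡ funToFin g
funToFin-cong {zero}  h = refl
funToFin-cong {suc m} h = cong₂ combine (h zero) (funToFin-cong (h ∘ suc))

*-^ : ∀ a b k → (a ℕ.* b) ℕ.^ k ≡ a ℕ.^ k ℕ.* b ℕ.^ k
*-^ a b zero = refl
*-^ a b (suc k) rewrite *-^ a b k = lem a b (a ℕ.^ k) (b ℕ.^ k)
  where
  lem : ∀ a b p q → a ℕ.* b ℕ.* (p ℕ.* q) ≡ a ℕ.* p ℕ.* (b ℕ.* q)
  lem = solveℕ-∀

polynomial-degree : ∀ k l K → (∀ N → suc N ℕ.^ l ≤ (K ℕ.* suc N) ℕ.^ k) → l ≤ k
polynomial-degree k l K h with l ℕ.≤? k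
... | yes le = le
... | no gt = ⊥-elim (ℕₚ.1+n≰n (ℕₚ.*-cancelʳ-≤ (suc N) N (suc N ℕ.^ k) {{ℕₚ.m^n≢0 (suc N) k}} (begin
  suc N ℕ.* suc N ℕ.^ k  ≤⟨ ℕₚ.^-monoʳ-≤ (suc N) (ℕₚ.≰⇒> gt) ⟩
  suc N ℕ.^ l            ≤⟨ h N ⟩
  (K ℕ.* suc N) ℕ.^ k    ≡⟨ *-^ K (suc N) k ⟩
  N ℕ.* suc N ℕ.^ k      ∎)))
  where
  open ℕₚ.≤-Reasoning
  -- Exactly the factor between (K (N + 1))^k and (N + 1)^k, so that l > k would force N + 1 ≤ N.
  N = K ℕ.^ k

-- Linear growth embeds the box [0, N]^l into a box of side O(N) in ℕ^k.
injection⇒≤ : ∀ {k l} (φ : Formula (k ℕ.+ l)) → (∀ y → Σ (Vec ℕ k) λ x → Sat φ (x ++ y)) →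
  (∀ x y y' → Sat φ (x ++ y) → Sat φ (x ++ y') → y ≡ y') → l ≤ k
injection⇒≤ {k} {l} φ total inj = polynomial-degree k l (suc (C ℕ.* suc l)) λ N →
  ℕₚ.≤-trans (Finₚ.injective⇒≤ (λ {i} {i'} → Box.encode-inj N {i} {i'})) (ℕₚ.^-monoˡ-≤ k (side N))
  where
  C = proj₁ (linear-growth k φ)

  module Box (N : ℕ) where
    point : Fin (suc N ℕ.^ l) → Vec ℕ l
    point i = tabulate (λ j → toℕ (finToFun {suc N} {l} i j))

    small : ∀ i → Vec.sum (point i) ≤ l ℕ.* N
    small i = sum-tabulate≤ _ (λ j → ℕₚ.≤-pred (Finₚ.toℕ<n (finToFun {suc N} {l} i j)))

    -- `linear-growth` may return a different `x` from the one given by `total`. This is harmless,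
    -- since any such `x` determines the point it belongs to.
    image : ∀ i → Σ (Vec ℕ k) λ x → Sat φ (x ++ point i) × Vec.sum x ≤ C ℕ.* suc (Vec.sum (point i))
    image i = let (x , s) = total (point i) in proj₂ (linear-growth k φ) (point i) x s

    coordinate≤ : ∀ i j → lookup (proj₁ (image i)) j ≤ C ℕ.* suc (l ℕ.* N)
    coordinate≤ i j = ℕₚ.≤-trans (lookup≤sum (proj₁ (image i)) j)
      (ℕₚ.≤-trans (proj₂ (proj₂ (image i))) (ℕₚ.*-monoʳ-≤ C (s≤s (small i))))

    encode : Fin (suc N ℕ.^ l) → Fin (suc (C ℕ.* suc (l ℕ.* N)) ℕ.^ k)
    encode i = funToFin (λ j → fromℕ< (s≤s (coordinate≤ i j)))

    encode-inj : ∀ {i i'} → encode i ≡ encode i' → i ≡ i'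
    encode-inj {i} {i'} e = trans (sym (Finₚ.funToFin-finToFin {l} {suc N} i))
      (trans (funToFin-cong same-digits) (Finₚ.funToFin-finToFin {l} {suc N} i'))
      where
      same-image : proj₁ (image i) ≡ proj₁ (image i')
      same-image = lookup-injective _ _ λ j → trans (sym (Finₚ.toℕ-fromℕ< (s≤s (coordinate≤ i j))))
        (trans (cong toℕ (trans (sym (Finₚ.finToFun-funToFin _ j))
          (trans (cong (λ c → finToFun {n = k} c j) e) (Finₚ.finToFun-funToFin _ j))))
        (Finₚ.toℕ-fromℕ< (s≤s (coordinate≤ i' j))))
      same-point : point i ≡ point i'
      same-point = inj (proj₁ (image i)) (point i) (point i') (proj₁ (proj₂ (image i)))
        (subst (λ x → Sat φ (x ++ point i')) (sym same-image) (proj₁ (proj₂ (image i'))))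
      same-digits : finToFun {suc N} {l} i ≗ finToFun i'
      same-digits j = Finₚ.toℕ-injective (trans (sym (lookup∘tabulate _ j))
        (trans (cong (λ x → lookup x j) same-point) (lookup∘tabulate _ j)))

  side : ∀ N → suc (C ℕ.* suc (l ℕ.* N)) ≤ suc (C ℕ.* suc l) ℕ.* suc N
  side N = begin
    suc (C ℕ.* suc (l ℕ.* N))                                  ≤⟨ ℕₚ.m≤m+n _ (N ℕ.+ C ℕ.* l ℕ.+ C ℕ.* N) ⟩
    suc (C ℕ.* suc (l ℕ.* N)) ℕ.+ (N ℕ.+ C ℕ.* l ℕ.+ C ℕ.* N)  ≡⟨ lem C l N ⟩
    suc (C ℕ.* suc l) ℕ.* suc N                                ∎
    where
    open ℕₚ.≤-Reasoning
    lem : ∀ C l N → suc (C ℕ.* suc (l ℕ.* N)) ℕ.+ (N ℕ.+ C ℕ.* l ℕ.+ C ℕ.* N) ≡ suc (C ℕ.* suc l) ℕ.* suc N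
    lem = solveℕ-∀

module _ {k} {M : Vec ℕ k → Set} {l} (b : DefBij M l) where
  private
    φ = proj₁ b
    isDomain = proj₁ (proj₂ b)

  DefBij-functional : ∀ x y y' → Sat φ (x ++ y) → Sat φ (x ++ y') → y ≡ y'
  DefBij-functional x y y' s s' with proj₁ (proj₂ (proj₂ b)) x (isDomain x y s)
  ... | _ , _ , unique = trans (unique y s) (sym (unique y' s'))

  DefBij-injective : ∀ x x' y → Sat φ (x ++ y) → Sat φ (x' ++ y) → x ≡ x'
  DefBij-injective x x' y s s' with proj₂ (proj₂ (proj₂ b)) y
  ... | _ , _ , unique = trans (unique x (isDomain x y s) s) (sym (unique x' (isDomain x' y s') s'))

  DefBij-surjective : ∀ y → Σ (Vec ℕ k) λ x → M x × Sat φ (x ++ y)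
  DefBij-surjective y = let (x , s , _) = proj₂ (proj₂ (proj₂ b)) y in x , s

  DefBij-total : ∀ {x} → M x → Σ (Vec ℕ l) λ y → Sat φ (x ++ y)
  DefBij-total {x} m = let (y , s , _) = proj₁ (proj₂ (proj₂ b)) x m in y , s

  DefBij⇒≤ : l ≤ k
  DefBij⇒≤ = injection⇒≤ φ (λ y → let (x , _ , s) = DefBij-surjective y in x , s)
    DefBij-functional

  DefBij-DefRel : DefRel k l (λ x y → Sat φ (x ++ y))
  DefBij-DefRel = φ , λ x y → id , id

-- The two powers are compared through `M`: relating the y' in ℕ^l' and the y in ℕ^l that come from
-- the same point of `M` embeds ℕ^l into ℕ^l'.
DefBij-≤ : ∀ {k} {M : Vec ℕ k → Set} {l l'} → DefBij M l → DefBij M l' → l ≤ l'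
DefBij-≤ {l = l} {l'} b b' with DefRel-comp (DefRel-converse (DefBij-DefRel b')) (DefBij-DefRel b)
... | ψ , e = injection⇒≤ ψ
  (λ y → let (x , m , s) = DefBij-surjective b y ; (y' , s') = DefBij-total b' m in y' , proj₁ (e y' y) (x , s' , s))
  (λ y' y₁ y₂ s₁ s₂ → same y' y₁ y₂ (proj₂ (e y' y₁) s₁) (proj₂ (e y' y₂) s₂))
  where
  same : ∀ y' y₁ y₂ → (Σ _ λ x → Sat (proj₁ b') (x ++ y') × Sat (proj₁ b) (x ++ y₁)) →
    (Σ _ λ x → Sat (proj₁ b') (x ++ y') × Sat (proj₁ b) (x ++ y₂)) → y₁ ≡ y₂
  same y' y₁ y₂ (x₁ , p₁ , q₁) (x₂ , p₂ , q₂) with DefBij-injective b' x₁ x₂ y' p₁ p₂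
  ... | refl = DefBij-functional b x₁ y₁ y₂ q₁ q₂

-- Parametrising by ℕ^l

record Embedding (l m : ℕ) : Set where
  field
    fun       : Vec ℕ l → Vec ℕ m
    definable : DefFun fun
    injective : ∀ u v → fun u ≡ fun v → u ≡ v

open Embedding

Image : ∀ {l m} → Embedding l m → Vec ℕ m → Set
Image e x = Σ _ λ z → x ≡ fun e z

_∘ᴱ_ : ∀ {k l m} → Embedding l m → Embedding k l → Embedding k m
e ∘ᴱ e' = record
  { fun       = fun e ∘ fun e'
  ; definable = DefFun-∘ (definable e) (definable e')
  ; injective = λ u v → injective e' u v ∘ injective e _ _
  }

DefFun-cong : ∀ {k l} {f g : Vec ℕ l → Vec ℕ k} → (∀ z → f z ≡ g z) → DefFun f → DefFun g
DefFun-cong h d = DefRel-resp d λ x z → (λ e → trans e (sym (h z))) , (λ e → trans e (h z))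

vars : ∀ {n} → Vec (NTerm n) n
vars = map var (allFin _)

eval-vars : ∀ {n} (z : Vec ℕ n) → map (λ t → evalN t z) vars ≡ z
eval-vars z = trans (sym (map-∘ _ var (allFin _))) (map-lookup-allFin z)

idᴱ : ∀ {n} → Embedding n n
idᴱ = record
  { fun = id ; definable = DefFun-cong eval-vars (DefFun-terms vars) ; injective = λ _ _ → id }

updateAt-definable : ∀ {n} (i : Fin n) (t : NTerm n → NTerm n) (f : Vec ℕ n → ℕ → ℕ) →
  (∀ s z → evalN (t s) z ≡ f z (evalN s z)) → DefFun (λ z → updateAt z i (f z))
updateAt-definable i t f h = DefFun-cong
  (λ z → trans (map-updateAt vars i (h (lookup vars i) z)) (cong (λ x → updateAt x i (f z)) (eval-vars z)))
  (DefFun-terms (updateAt vars i t))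

updateAt-injective : ∀ {n} (i : Fin n) {f : ℕ → ℕ} → (∀ a b → f a ≡ f b → a ≡ b) →
  ∀ (u v : Vec ℕ n) → updateAt u i f ≡ updateAt v i f → u ≡ v
updateAt-injective zero    h (a ∷ u) (b ∷ v) e = cong₂ _∷_ (h a b (∷-injectiveˡ e)) (∷-injectiveʳ e)
updateAt-injective (suc i) h (a ∷ u) (b ∷ v) e =
  cong₂ _∷_ (∷-injectiveˡ e) (updateAt-injective i h u v (∷-injectiveʳ e))

-- For r < d the image is a residue class. All r are allowed, so that d = 1 and r = 1 give the
-- successor.
scaleᴱ : ∀ {n} (i : Fin n) d → .{{NonZero d}} → ℕ → Embedding n n
scaleᴱ i d r = record
  { fun       = λ z → updateAt z i (λ v → d ℕ.* v ℕ.+ r)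
  ; definable = updateAt-definable i (λ t → (d ⊠ t) ⊞ const r) (λ _ v → d ℕ.* v ℕ.+ r) (λ _ _ → refl)
  ; injective = updateAt-injective i (λ a b e → ℕₚ.*-cancelˡ-≡ a b d (ℕₚ.+-cancelʳ-≡ r _ _ e))
  }

-- The image is the half where x_j ≤ x_i; its inverse there is subtraction.
shearᴱ : ∀ {n} (i j : Fin n) → j ≢ i → Embedding n n
shearᴱ i j j≢i = record
  { fun       = λ z → updateAt z i (ℕ._+ lookup z j)
  ; definable = updateAt-definable i (_⊞ var j) (λ z → ℕ._+ lookup z j) (λ _ _ → refl)
  ; injective = λ u v e → inj u v
      (trans (sym (lookup∘updateAt′ j i j≢i u)) (trans (cong (λ x → lookup x j) e) (lookup∘updateAt′ j i j≢i v))) e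
  }
  where
  inj : ∀ u v → lookup u j ≡ lookup v j → updateAt u i (ℕ._+ lookup u j) ≡ updateAt v i (ℕ._+ lookup v j) → u ≡ v
  inj u v eq e rewrite eq = updateAt-injective i (λ a b → ℕₚ.+-cancelʳ-≡ (lookup v j) a b) u v e

zeroᴱ : ∀ {n} → Fin (suc n) → Embedding n (suc n)
zeroᴱ i = record
  { fun       = λ z → insertAt z i 0
  ; definable = DefFun-cong (λ z → trans (map-insertAt _ (const 0) vars i) (cong (λ x → insertAt x i 0) (eval-vars z)))
                  (DefFun-terms (insertAt vars i (const 0)))
  ; injective = λ u v e → trans (sym (removeAt-insertAt u i 0)) (trans (cong (λ x → removeAt x i) e) (removeAt-insertAt v i 0))
  }

pointᴱ : ∀ {n} → Vec ℕ n → Embedding 0 n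
pointᴱ x = record
  { fun       = λ _ → x
  ; definable = DefFun-cong (λ z → trans (sym (map-∘ _ const x)) (map-id x)) (DefFun-terms (map const x))
  ; injective = λ { [] [] _ → refl }
  }

-- Cutting a power of ℕ into two copies of powers

record Split (l₁ l₂ m : ℕ) : Set where
  field
    e₁       : Embedding l₁ m
    e₂       : Embedding l₂ m
    cover    : ∀ x → Image e₁ x ⊎ Image e₂ x
    disjoint : ∀ z w → fun e₁ z ≢ fun e₂ w

scale-cover : ∀ {n} (i : Fin n) d .{{_ : NonZero d}} r x → lookup x i % d ≡ r → Image (scaleᴱ i d r) x
scale-cover i d r x refl = updateAt x i (_/ d) ,
  sym (trans (updateAt-updateAt i x) (updateAt-id-local i x
    (trans (ℕₚ.+-comm _ (lookup x i % d)) (trans (cong (lookup x i % d ℕ.+_) (ℕₚ.*-comm d _)) (sym (m≡m%n+[m/n]*n (lookup x i) d))))))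

scale-residue : ∀ {n} (i : Fin n) d .{{_ : NonZero d}} r z → r < d → lookup (fun (scaleᴱ i d r) z) i % d ≡ r
scale-residue i d r z r<d = trans (cong (_% d) (lookup∘updateAt i z))
  (trans (cong (_% d) (trans (ℕₚ.+-comm (d ℕ.* lookup z i) r) (cong (r ℕ.+_) (ℕₚ.*-comm d (lookup z i)))))
  (trans ([m+kn]%n≡m%n r (lookup z i) d) (m<n⇒m%n≡m r<d)))

paritySplit : ∀ {n} → Split (suc n) (suc n) (suc n)
paritySplit = record
  { e₁       = scaleᴱ zero 2 0
  ; e₂       = scaleᴱ zero 2 1
  ; cover    = λ x → cov x (lookup x zero % 2) refl (m%n<n (lookup x zero) 2)
  ; disjoint = λ z w e → case (trans (sym (scale-residue zero 2 0 z (s≤s z≤n)))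
                 (trans (cong (λ x → lookup x zero % 2) e) (scale-residue zero 2 1 w (s≤s (s≤s z≤n)))))
  }
  where
  case : 0 ≡ 1 → ⊥
  case ()
  cov : ∀ x r → lookup x zero % 2 ≡ r → r < 2 → Image (scaleᴱ zero 2 0) x ⊎ Image (scaleᴱ zero 2 1) x
  cov x 0 e _ = inj₁ (scale-cover zero 2 0 x e)
  cov x 1 e _ = inj₂ (scale-cover zero 2 1 x e)
  cov x (suc (suc r)) e (s≤s (s≤s ()))

sucᴱ : ∀ {n} → Fin n → Embedding n n
sucᴱ i = scaleᴱ i 1 1

lookup-sucᴱ : ∀ {n} (i : Fin n) z → lookup (fun (sucᴱ i) z) i ≡ suc (lookup z i)
lookup-sucᴱ i z = trans (lookup∘updateAt i z) (trans (ℕₚ.+-comm _ 1) (cong suc (ℕₚ.+-identityʳ _)))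

suc-cover : ∀ {n} (i : Fin n) x {a} → lookup x i ≡ suc a → Image (sucᴱ i) x
suc-cover i x {a} e = updateAt x i ℕ.pred , sym (trans (updateAt-updateAt i x)
  (updateAt-id-local i x (trans (cong (λ v → 1 ℕ.* ℕ.pred v ℕ.+ 1) e) (trans (ℕₚ.+-comm _ 1) (trans (cong suc (ℕₚ.+-identityʳ a)) (sym e))))))

peelSplit : ∀ {n} → Fin (suc n) → Split n (suc n) (suc n)
peelSplit i = record
  { e₁       = zeroᴱ i
  ; e₂       = sucᴱ i
  ; cover    = λ x → cov x (lookup x i) refl
  ; disjoint = λ z w e → case (trans (sym (insertAt-lookup z i 0)) (trans (cong (λ x → lookup x i) e) (lookup-sucᴱ i w)))
  }
  where
  case : ∀ {a} → 0 ≡ suc a → ⊥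
  case ()
  cov : ∀ x a → lookup x i ≡ a → Image (zeroᴱ i) x ⊎ Image (sucᴱ i) x
  cov x zero    e = inj₁ (removeAt x i , trans (sym (insertAt-removeAt x i)) (cong (insertAt (removeAt x i) i) e))
  cov x (suc a) e = inj₂ (suc-cover i x e)

shear-cover : ∀ {n} (i j : Fin n) j≢i x → lookup x j ≤ lookup x i → Image (shearᴱ i j j≢i) x
shear-cover i j j≢i x le = z , sym (trans (updateAt-updateAt-local i {h = id} x eq) (updateAt-id-local i x refl))
  where
  z = updateAt x i (ℕ._∸ lookup x j)
  eq : lookup x i ℕ.∸ lookup x j ℕ.+ lookup z j ≡ lookup x i
  eq = trans (cong (lookup x i ℕ.∸ lookup x j ℕ.+_) (lookup∘updateAt′ j i j≢i x)) (ℕₚ.m∸n+n≡m le)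

compareSplit : ∀ {n} (i j : Fin n) → i ≢ j → Split n n n
compareSplit {n} i j i≢j = record
  { e₁       = shearᴱ i j (i≢j ∘ sym)
  -- The successor makes this half strict, so the diagonal belongs to the first one only.
  ; e₂       = shearᴱ j i i≢j ∘ᴱ sucᴱ j
  ; cover    = cov
  ; disjoint = λ z w e → ℕₚ.<⇒≱ (less w) (subst (λ x → lookup x j ≤ lookup x i) e (geq z))
  }
  where
  geq : ∀ z → lookup (fun (shearᴱ i j (i≢j ∘ sym)) z) j ≤ lookup (fun (shearᴱ i j (i≢j ∘ sym)) z) i
  geq z rewrite lookup∘updateAt′ j i {ℕ._+ lookup z j} (i≢j ∘ sym) z | lookup∘updateAt i {ℕ._+ lookup z j} z = ℕₚ.m≤n+m _ _
  less : ∀ w → lookup (fun (shearᴱ j i i≢j ∘ᴱ sucᴱ j) w) i < lookup (fun (shearᴱ j i i≢j ∘ᴱ sucᴱ j) w) j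
  less w = less' (fun (sucᴱ j) w) (lookup-sucᴱ j w)
    where
    less' : ∀ v {a} → lookup v j ≡ suc a → lookup (fun (shearᴱ j i i≢j) v) i < lookup (fun (shearᴱ j i i≢j) v) j
    less' v e rewrite lookup∘updateAt′ i j {ℕ._+ lookup v i} i≢j v | lookup∘updateAt j {ℕ._+ lookup v i} v | e = s≤s (ℕₚ.m≤n+m _ _)
  cov : ∀ x → Image (shearᴱ i j (i≢j ∘ sym)) x ⊎ Image (shearᴱ j i i≢j ∘ᴱ sucᴱ j) x
  cov x with lookup x j ℕ.≤? lookup x i
  ... | yes le = inj₁ (shear-cover i j (i≢j ∘ sym) x le)
  ... | no gt with shear-cover j i i≢j x (ℕₚ.<⇒≤ (ℕₚ.≰⇒> gt))
  ... | z , refl with lookup z j in e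
  ... | suc a = let (w , e') = suc-cover j z e in inj₂ (w , cong (fun (shearᴱ j i i≢j)) e')
  ... | zero = ⊥-elim (gt (ℕₚ.≤-reflexive (trans (lookup∘updateAt j z) (trans (cong (ℕ._+ lookup z i) e) (sym (lookup∘updateAt′ i j i≢j z))))))

-- Gluing parametrisations of disjoint sets

_∪_ : ∀ {m} → (Vec ℕ m → Set) → (Vec ℕ m → Set) → Vec ℕ m → Set
(X ∪ Y) x = X x ⊎ Y x

Disjoint : ∀ {m} → (Vec ℕ m → Set) → (Vec ℕ m → Set) → Set
Disjoint X Y = ∀ x → X x → Y x → ⊥

Param : ∀ {m} → ℕ → (Vec ℕ m → Set) → Set
Param l X = Σ (Embedding l _) λ e → ∀ x → X x ⟷ Image e x

Param-resp : ∀ {m l} {X Y : Vec ℕ m → Set} → (∀ x → Y x ⟷ X x) → Param l X → Param l Y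
Param-resp h (e , im) = e , λ x → ⟷-trans (h x) (im x)

-- `cover` computes which half a parameter lies in, and the value follows p or q accordingly.
-- Definability does not go through `cover`: the graph is the union of p ∘ e₁⁻¹ and q ∘ e₂⁻¹,
-- composed as relations.
glue : ∀ {m l₁ l₂ l} {X Y : Vec ℕ m → Set} → Split l₁ l₂ l → Param l₁ X → Param l₂ Y → Disjoint X Y → Param l (X ∪ Y)
glue {m} {l₁} {l₂} {l} {X} {Y} S (p , imX) (q , imY) disj = e , im
  where
  open Split S
  value : ∀ {w} → Image e₁ w ⊎ Image e₂ w → Vec ℕ m
  value (inj₁ (z , _)) = fun p z
  value (inj₂ (z , _)) = fun q z
  f : Vec ℕ l → Vec ℕ m
  f w = value (cover w)
  f-e₁ : ∀ z → f (fun e₁ z) ≡ fun p z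
  f-e₁ z with cover (fun e₁ z)
  ... | inj₁ (z' , eq) = cong (fun p) (sym (injective e₁ z z' eq))
  ... | inj₂ (w , eq)  = ⊥-elim (disjoint z w eq)
  f-e₂ : ∀ z → f (fun e₂ z) ≡ fun q z
  f-e₂ z with cover (fun e₂ z)
  ... | inj₁ (w , eq)  = ⊥-elim (disjoint w z (sym eq))
  ... | inj₂ (z' , eq) = cong (fun q) (sym (injective e₂ z z' eq))
  inj : ∀ u v → f u ≡ f v → u ≡ v
  inj u v eq with cover u | cover v
  ... | inj₁ (z , refl) | inj₁ (z' , refl) = cong (fun e₁) (injective p z z' eq)
  ... | inj₂ (z , refl) | inj₂ (z' , refl) = cong (fun e₂) (injective q z z' eq)
  ... | inj₁ (z , _) | inj₂ (z' , _) = ⊥-elim (disj _ (proj₂ (imX _) (z , refl)) (proj₂ (imY _) (z' , eq)))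
  ... | inj₂ (z , _) | inj₁ (z' , _) = ⊥-elim (disj _ (proj₂ (imX _) (z' , refl)) (proj₂ (imY _) (z , sym eq)))
  def : DefFun f
  def = DefRel-resp
    (DefRel-∪ (DefRel-comp (definable p) (DefRel-converse (definable e₁)))
              (DefRel-comp (definable q) (DefRel-converse (definable e₂))))
    λ x w → (λ eq → to x w eq (cover w) refl) ,
      (λ { (inj₁ (z , eq , refl)) → trans eq (sym (f-e₁ z))
         ; (inj₂ (z , eq , refl)) → trans eq (sym (f-e₂ z)) })
    where
    to : ∀ x w → x ≡ f w → (c : Image e₁ w ⊎ Image e₂ w) → cover w ≡ c →
      (Σ (Vec ℕ l₁) λ z → x ≡ fun p z × w ≡ fun e₁ z) ⊎ (Σ (Vec ℕ l₂) λ z → x ≡ fun q z × w ≡ fun e₂ z)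
    to x w eq (inj₁ (z , eq')) c = inj₁ (z , trans eq (cong value c) , eq')
    to x w eq (inj₂ (z , eq')) c = inj₂ (z , trans eq (cong value c) , eq')
  e : Embedding l m
  e = record { fun = f ; definable = def ; injective = inj }
  im : ∀ x → (X ∪ Y) x ⟷ Image e x
  im x = (λ { (inj₁ Xx) → let (z , eq) = proj₁ (imX x) Xx in fun e₁ z , trans eq (sym (f-e₁ z))
            ; (inj₂ Yx) → let (z , eq) = proj₁ (imY x) Yx in fun e₂ z , trans eq (sym (f-e₂ z)) }) ,
         λ (w , eq) → from w eq (cover w) refl
    where
    from : ∀ w → x ≡ f w → (c : Image e₁ w ⊎ Image e₂ w) → cover w ≡ c → (X ∪ Y) x
    from w eq (inj₁ (z , _)) c = inj₁ (proj₂ (imX x) (z , trans eq (cong value c)))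
    from w eq (inj₂ (z , _)) c = inj₂ (proj₂ (imY x) (z , trans eq (cong value c)))

-- Hilbert's hotel: for a ≤ l, ℕ^a is absorbed by the face {0} × ℕ^l of ℕ^(l+1); for a = l + 1 interleave.
absorb : ∀ {m} l a {X Y : Vec ℕ m → Set} → a ≤ suc l → Param (suc l) X → Param a Y → Disjoint X Y → Param (suc l) (X ∪ Y)
absorb l a a≤1+l P Q disj with a ℕ.≟ suc l
... | yes refl = glue paritySplit P Q disj
absorb l a a≤1+l P Q disj | no a≢1+l with a ℕ.≟ l
-- Y takes the face where the first coordinate is 0, and X moves up one step along that coordinate.
... | yes refl = Param-resp (λ x → swap , swap) (glue (peelSplit zero) Q P (λ x Yx Xx → disj x Xx Yx))
absorb zero a a≤1+l P Q disj | no a≢1+l | no a≢l = ⊥-elim (a≢l (ℕₚ.n<1⇒n≡0 (ℕₚ.≤∧≢⇒< a≤1+l a≢1+l)))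
absorb {m} (suc l) a {X} {Y} a≤2+l (p , im) Q disj | no a≢2+l | no a≢1+l =
  Param-resp (λ x → to x , from x) (glue (peelSplit zero)
    (absorb l a (ℕₚ.≤-pred (ℕₚ.≤∧≢⇒< a≤2+l a≢2+l)) (face , λ _ → id , id) Q (λ x → λ { (z , refl) → disj _ (proj₂ (im _) (_ , refl)) }))
    (rest , λ _ → id , id)
    λ { x (inj₁ (z , eq)) (w , eq') → disjoint z w (injective p _ _ (trans (sym eq) eq'))
      ; x (inj₂ Yx) (w , refl) → disj _ (proj₂ (im _) (_ , refl)) Yx })
  where
  open Split (peelSplit {suc l} zero)
  face = p ∘ᴱ e₁
  rest = p ∘ᴱ e₂
  to : ∀ x → (X ∪ Y) x → ((Image face ∪ Y) ∪ Image rest) x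
  to x (inj₂ Yx) = inj₁ (inj₂ Yx)
  to x (inj₁ Xx) with proj₁ (im x) Xx
  ... | w , refl with cover w
  ... | inj₁ (z , refl) = inj₁ (inj₁ (z , refl))
  ... | inj₂ (z , refl) = inj₂ (z , refl)
  from : ∀ x → ((Image face ∪ Y) ∪ Image rest) x → (X ∪ Y) x
  from x (inj₁ (inj₁ (z , eq))) = inj₁ (proj₂ (im x) (_ , eq))
  from x (inj₁ (inj₂ Yx))       = inj₂ Yx
  from x (inj₂ (z , eq))        = inj₁ (proj₂ (im x) (_ , eq))

-- A point is a copy of ℕ^0; uniqueness of the list keeps the successive points disjoint from what
-- has been absorbed.
absorb-list : ∀ {m l} {X : Vec ℕ m → Set} L → Unique L → Param (suc l) X → Disjoint X (_∈ L) → Param (suc l) (X ∪ (_∈ L))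
absorb-list [] _ P _ = Param-resp (λ x → (λ { (inj₁ Xx) → Xx ; (inj₂ ()) }) , inj₁) P
absorb-list {m} {l} {X} (y ∷ L) (y∉L ∷ U) P disj = Param-resp
  (λ x → (λ { (inj₁ Xx) → inj₁ (inj₁ Xx) ; (inj₂ (here e)) → inj₂ ([] , e) ; (inj₂ (there x∈)) → inj₁ (inj₂ x∈) }) ,
         (λ { (inj₁ (inj₁ Xx)) → inj₁ Xx ; (inj₁ (inj₂ x∈)) → inj₂ (there x∈) ; (inj₂ ([] , e)) → inj₂ (here e) }))
  (absorb l 0 z≤n (absorb-list L U P (λ x Xx x∈ → disj x Xx (there x∈))) (pointᴱ y , λ _ → id , id)
    λ { x (inj₁ Xx) (_ , e) → disj x Xx (here e) ; x (inj₂ x∈) (_ , refl) → All.lookup y∉L x∈ refl })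

-- The dichotomy to be computed. The finite case is what `Infinite` refutes, and the exponent
-- `suc l` in the other case supplies the bound 1 ≤ l of the theorem.
data Nice {m} (X : Vec ℕ m → Set) : Set where
  finite   : ∀ L → Unique L → (∀ x → X x ⟷ x ∈ L) → Nice X
  infinite : ∀ l → Param (suc l) X → Nice X

Nice-resp : ∀ {m} {X Y : Vec ℕ m → Set} → (∀ x → Y x ⟷ X x) → Nice X → Nice Y
Nice-resp h (finite L U e)  = finite L U (λ x → ⟷-trans (h x) (e x))
Nice-resp h (infinite l P) = infinite l (Param-resp h P)

∪-swap : ∀ {m} {X Y : Vec ℕ m → Set} → Nice (X ∪ Y) → Nice (Y ∪ X)
∪-swap = Nice-resp λ x → swap , swap

Nice-∪ : ∀ {m} {X Y : Vec ℕ m → Set} → Nice X → Nice Y → Disjoint X Y → Nice (X ∪ Y)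
Nice-∪ (finite L U e) (finite L' U' e') disj =
  finite (L List.++ L') (Uniqueₚ.++⁺ U U' (λ (p , q) → disj _ (proj₂ (e _) p) (proj₂ (e' _) q)))
    λ x → (λ { (inj₁ Xx) → ∈-++⁺ˡ (proj₁ (e x) Xx) ; (inj₂ Yx) → ∈-++⁺ʳ L (proj₁ (e' x) Yx) }) ,
          λ x∈ → [ inj₁ ∘ proj₂ (e x) , inj₂ ∘ proj₂ (e' x) ]′ (∈-++⁻ L x∈)
Nice-∪ (infinite l P) (finite L U e) disj = infinite l (Param-resp
  (λ x → (λ { (inj₁ Xx) → inj₁ Xx ; (inj₂ Yx) → inj₂ (proj₁ (e x) Yx) }) ,
         (λ { (inj₁ Xx) → inj₁ Xx ; (inj₂ x∈) → inj₂ (proj₂ (e x) x∈) }))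
  (absorb-list L U P (λ x Xx x∈ → disj x Xx (proj₂ (e x) x∈))))
Nice-∪ N@(finite _ _ _) N'@(infinite _ _) disj = ∪-swap (Nice-∪ N' N (λ x Yx Xx → disj x Xx Yx))
Nice-∪ (infinite l P) (infinite l' P') disj with ℕₚ.≤-total l' l
... | inj₁ le = infinite l (absorb l (suc l') (s≤s le) P P' disj)
... | inj₂ le = ∪-swap (infinite l' (absorb l' (suc l) (s≤s le) P' P (λ x Yx Xx → disj x Xx Yx)))

Nice-image : ∀ {l m} (e : Embedding l m) {X : Vec ℕ m → Set} → Nice (X ∘ fun e) → Nice (λ x → Image e x × X x)
Nice-image e (finite L U h) = finite (List.map (fun e) L) (Uniqueₚ.map⁺ (injective e _ _) U)
  λ x → (λ { ((z , refl) , Xx) → ∈-map⁺ (fun e) (proj₁ (h z) Xx) }) ,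
        λ x∈ → let (z , z∈ , eq) = ∈-map⁻ (fun e) x∈ in from z z∈ eq
  where
  from : ∀ {x} z → z ∈ L → x ≡ fun e z → _
  from z z∈ refl = (z , refl) , proj₂ (h z) z∈
Nice-image {l} {m} e {X} (infinite k (p , im)) = infinite k (e ∘ᴱ p , λ x →
  (λ { ((z , refl) , Xx) → let (w , eq) = proj₁ (im z) Xx in w , cong (fun e) eq }) ,
  (λ { (w , refl) → (fun p w , refl) , proj₂ (im _) (w , refl) }))

Nice-split : ∀ {l₁ l₂ m} (S : Split l₁ l₂ m) {X : Vec ℕ m → Set} →
  Nice (X ∘ fun (Split.e₁ S)) → Nice (X ∘ fun (Split.e₂ S)) → Nice X
Nice-split S N₁ N₂ = Nice-resp
  (λ x → (λ Xx → [ (λ i → inj₁ (i , Xx)) , (λ i → inj₂ (i , Xx)) ]′ (cover x)) ,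
         [ proj₂ , proj₂ ]′)
  (Nice-∪ (Nice-image e₁ N₁) (Nice-image e₂ N₂)
    λ { x ((z , refl) , _) ((w , eq) , _) → disjoint z w eq })
  where open Split S

-- The residue classes are added one by one, so only disjoint unions of two sets are needed.
Nice-residue : ∀ {m} (i : Fin m) d .{{_ : NonZero d}} {X : Vec ℕ m → Set} →
  (∀ r → Nice (X ∘ fun (scaleᴱ i d r))) → Nice X
Nice-residue {m} i d {X} N = Nice-resp (λ x → (λ Xx → Xx , m%n<n (lookup x i) d) , proj₁) (below d ℕₚ.≤-refl)
  where
  below : ∀ b → b ≤ d → Nice (λ x → X x × lookup x i % d < b)
  below zero    _   = finite [] [] λ x → (λ ()) , λ ()
  below (suc b) b<d = Nice-resp
    (λ x → to x , λ { (inj₁ (Xx , lt)) → Xx , ℕₚ.m<n⇒m<1+n lt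
                     ; (inj₂ ((z , refl) , Xx)) → Xx , s≤s (ℕₚ.≤-reflexive (scale-residue i d b z b<d)) })
    (Nice-∪ (below b (ℕₚ.<⇒≤ b<d)) (Nice-image (scaleᴱ i d b) {X} (N b))
      λ { x (_ , lt) ((z , refl) , _) → ℕₚ.<⇒≢ lt (scale-residue i d b z b<d) })
    where
    to : ∀ x → X x × lookup x i % d < suc b → (X x × lookup x i % d < b) ⊎ (Image (scaleᴱ i d b) x × X x)
    to x (Xx , lt) with lookup x i % d ℕ.≟ b
    ... | yes e = inj₂ (scale-cover i d b x e , Xx)
    ... | no ne = inj₁ (Xx , ℕₚ.≤∧≢⇒< (ℕₚ.≤-pred lt) ne)

Nice-full : ∀ {m} {X : Vec ℕ m → Set} → (∀ x → X x) → Nice X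
Nice-full {zero}  all = finite ([] ∷ []) ([] ∷ []) λ { [] → (λ _ → here refl) , (λ _ → all []) }
Nice-full {suc m} all = infinite m (idᴱ , λ x → (λ _ → x , refl) , (λ _ → all x))

-- Decomposition of Presburger sets

dot-scale : ∀ {n} (a : Vec ℤ n) i d r z →
  dot (updateAt a i (+ d *_)) z + lookup a i * + r ≡ dot a (updateAt z i (λ v → d ℕ.* v ℕ.+ r))
dot-scale (a ∷ as) zero d r (x ∷ z) = trans (lem a (+ d) (+ x) (+ r) (dot as z))
  (cong (λ t → a * t + dot as z) (trans (cong (_+ + r) (sym (ℤₚ.pos-* d x))) (sym (ℤₚ.pos-+ (d ℕ.* x) r))))
  where
  lem : ∀ a d x r p → d * a * x + p + a * r ≡ a * (d * x + r) + p
  lem = solve-∀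
dot-scale (a ∷ as) (suc i) d r (x ∷ z) = trans (ℤₚ.+-assoc (a * + x) _ _) (cong (_+_ (a * + x)) (dot-scale as i d r z))

dot-bump-point : ∀ {n} (a : Vec ℤ n) i t z → dot a (updateAt z i (ℕ._+ t)) ≡ dot a z + lookup a i * + t
dot-bump-point (a ∷ as) zero t (x ∷ z) = trans (cong (λ s → a * s + dot as z) (ℤₚ.pos-+ x t)) (lem a (+ x) (+ t) (dot as z))
  where
  lem : ∀ a x t p → a * (x + t) + p ≡ a * x + p + a * t
  lem = solve-∀
dot-bump-point (a ∷ as) (suc i) t (x ∷ z) = trans (cong (_+_ (a * + x)) (dot-bump-point as i t z)) (sym (ℤₚ.+-assoc (a * + x) _ _))

dot-bump-coef : ∀ {n} (a : Vec ℤ n) j s z → dot (updateAt a j (_+ s)) z ≡ dot a z + s * + lookup z j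
dot-bump-coef (a ∷ as) zero s (x ∷ z) = lem a (+ x) s (dot as z)
  where
  lem : ∀ a x s p → (a + s) * x + p ≡ a * x + p + s * x
  lem = solve-∀
dot-bump-coef (a ∷ as) (suc j) s (x ∷ z) = trans (cong (_+_ (a * + x)) (dot-bump-coef as j s z)) (sym (ℤₚ.+-assoc (a * + x) _ _))

dot-insert-0 : ∀ {n} (a : Vec ℤ (suc n)) i z → dot (removeAt a i) z ≡ dot a (insertAt z i 0)
dot-insert-0 (a ∷ as) zero z = sym (trans (cong (_+ dot as z) (ℤₚ.*-zeroʳ a)) (ℤₚ.+-identityˡ (dot as z)))
dot-insert-0 (a ∷ as@(_ ∷ _)) (suc i) (x ∷ z) = cong (_+_ (a * + x)) (dot-insert-0 as i z)

-- Restricting a set to a piece substitutes the parametrisation into its forms. Their number and the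
-- modulus survive, which is what the induction below relies on.
record Pullback {l m} (e : Embedding l m) : Set where
  field
    pull   : Form m → Form l
    ⟦pull⟧ : ∀ f z → ⟦ pull f ⟧ z ≡ ⟦ f ⟧ (fun e z)

open Pullback

scale* : ∀ {n} (i : Fin n) d .{{_ : NonZero d}} r → Pullback (scaleᴱ i d r)
scale* i d r = record
  { pull   = λ (a , c) → updateAt a i (+ d *_) , lookup a i * + r + c
  ; ⟦pull⟧ = λ (a , c) z → trans (sym (ℤₚ.+-assoc (dot (updateAt a i (+ d *_)) z) _ c)) (cong (_+ c) (dot-scale a i d r z))
  }

shear* : ∀ {n} (i j : Fin n) (j≢i : j ≢ i) → Pullback (shearᴱ i j j≢i)
shear* i j j≢i = record
  { pull   = λ (a , c) → updateAt a j (_+ lookup a i) , c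
  ; ⟦pull⟧ = λ (a , c) z → cong (_+ c) (trans (dot-bump-coef a j (lookup a i) z) (sym (dot-bump-point a i (lookup z j) z)))
  }

zero* : ∀ {n} (i : Fin (suc n)) → Pullback (zeroᴱ i)
zero* i = record
  { pull   = λ (a , c) → removeAt a i , c
  ; ⟦pull⟧ = λ (a , c) z → cong (_+ c) (dot-insert-0 a i z)
  }

_∘*_ : ∀ {k l m} {e : Embedding l m} {e' : Embedding k l} → Pullback e → Pullback e' → Pullback (e ∘ᴱ e')
_∘*_ {e' = e'} p q = record
  { pull   = pull q ∘ pull p
  ; ⟦pull⟧ = λ f z → trans (⟦pull⟧ q (pull p f) z) (⟦pull⟧ p f (fun e' z))
  }

-- Each coordinate of `fun e` is an affine form in the parameters, a pulled back coordinate form,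
-- and integer affine forms respect congruences.
Pullback-CongV : ∀ {l m D} {e : Embedding l m} → Pullback e → ∀ {u v} → CongV D u v → CongV D (fun e u) (fun e v)
Pullback-CongV {D = D} p {u} {v} h i = subst₂ (Cong D) (coord u) (coord v) (Cong-⟦⟧ (pull p (coordF i)) h)
  where
  coord = λ z → trans (⟦pull⟧ p (coordF i) z) (⟦⟧-coordF i _)

Pullback-Determined : ∀ {l m D} {e : Embedding l m} (p : Pullback e) {F X} →
  Determined F D X → Determined (List.map (pull p) F) D (X ∘ fun e)
Pullback-Determined {e = e} p det u v s c = det (fun e u) (fun e v)
  (All.map (λ {f} eq → trans (cong nonneg (sym (⟦pull⟧ p f u))) (trans eq (cong nonneg (⟦pull⟧ p f v)))) (Allₚ.map⁻ s))
  (Pullback-CongV p c)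

-- `is` lists the coordinates on which membership may still depend. Restricting to a residue class
-- of one of them removes it; with none left the set is full or empty, and testing the origin tells
-- which.
periodic-Nice : ∀ {m} D .{{_ : NonZero D}} (is : List (Fin m)) (X : Vec ℕ m → Set) →
  (∀ u v → All (λ i → Cong D (+ lookup u i) (+ lookup v i)) is → X u → X v) → (∀ u → Dec (X u)) → Nice X
periodic-Nice D [] X per dec with dec (replicate _ 0)
... | yes X0 = Nice-full (λ x → per _ x [] X0)
... | no ¬X0 = finite [] [] λ x → (λ Xx → ⊥-elim (¬X0 (per x _ [] Xx))) , λ ()
periodic-Nice D (i ∷ is) X per dec = Nice-residue i D λ r →
  periodic-Nice D is (X ∘ fun (scaleᴱ i D r)) (λ u v h → per _ _ (at-i r u v ∷ All.map (λ {j} → at-j r u v j) h)) (dec ∘ fun (scaleᴱ i D r))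
  where
  at-i : ∀ r u v → Cong D (+ lookup (updateAt u i (λ v → D ℕ.* v ℕ.+ r)) i) (+ lookup (updateAt v i (λ v → D ℕ.* v ℕ.+ r)) i)
  at-i r u v rewrite lookup∘updateAt i {λ v → D ℕ.* v ℕ.+ r} u | lookup∘updateAt i {λ v → D ℕ.* v ℕ.+ r} v =
    + lookup u i - + lookup v i , trans (eq (lookup u i)) (trans (lem (+ D) (+ lookup u i) (+ lookup v i) (+ r))
      (cong (_+ (+ lookup u i - + lookup v i) * + D) (sym (eq (lookup v i)))))
    where
    eq : ∀ x → + (D ℕ.* x ℕ.+ r) ≡ + D * + x + + r
    eq x = trans (ℤₚ.pos-+ (D ℕ.* x) r) (cong (_+ + r) (ℤₚ.pos-* D x))
    lem : ∀ d x y r → d * x + r ≡ d * y + r + (x - y) * d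
    lem = solve-∀
  at-j : ∀ r u v j → Cong D (+ lookup u j) (+ lookup v j) →
    Cong D (+ lookup (updateAt u i (λ v → D ℕ.* v ℕ.+ r)) j) (+ lookup (updateAt v i (λ v → D ℕ.* v ℕ.+ r)) j)
  at-j r u v j h with j Finₚ.≟ i
  ... | yes refl = at-i r u v
  ... | no j≢i rewrite lookup∘updateAt′ j i {λ v → D ℕ.* v ℕ.+ r} j≢i u | lookup∘updateAt′ j i {λ v → D ℕ.* v ℕ.+ r} j≢i v = h

-- Removing the sign conditions one at a time

nonzero : ℤ → ℕ
nonzero (+ zero) = 0
nonzero _        = 1

nonzeros : ∀ {n} → Vec ℤ n → ℕ
nonzeros []       = 0
nonzeros (a ∷ as) = nonzero a ℕ.+ nonzeros as

nonzeros-updateAt : ∀ {n} (a : Vec ℤ n) i (f : ℤ → ℤ) →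
  nonzeros (updateAt a i f) ℕ.+ nonzero (lookup a i) ≡ nonzeros a ℕ.+ nonzero (f (lookup a i))
nonzeros-updateAt (a ∷ as) zero f = lem (nonzero (f a)) (nonzeros as) (nonzero a)
  where
  lem : ∀ x y z → x ℕ.+ y ℕ.+ z ≡ z ℕ.+ y ℕ.+ x
  lem = solveℕ-∀
nonzeros-updateAt (a ∷ as) (suc i) f = trans (ℕₚ.+-assoc (nonzero a) _ _)
  (trans (cong (nonzero a ℕ.+_) (nonzeros-updateAt as i f)) (sym (ℕₚ.+-assoc (nonzero a) _ _)))

lookup-removeAt : ∀ {n} (a : Vec ℤ (suc n)) i j → lookup (removeAt a i) j ≡ lookup a (punchIn i j)
lookup-removeAt (a ∷ as)         zero    j       = refl
lookup-removeAt (a ∷ as@(_ ∷ _)) (suc i) zero    = refl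
lookup-removeAt (a ∷ as@(_ ∷ _)) (suc i) (suc j) = lookup-removeAt as i j

Nonneg : ∀ {n} → Vec ℤ n → Set
Nonneg a = ∀ i → nonneg (lookup a i) ≡ true

dot-Nonneg : ∀ {n} (a : Vec ℤ n) → Nonneg a → ∀ u → Σ ℕ λ k → dot a u ≡ + k
dot-Nonneg [] h [] = 0 , refl
dot-Nonneg (a ∷ as) h (x ∷ u) with nonneg⇒+ a (h zero) | dot-Nonneg as (h ∘ suc) u
... | n , refl | k , e = n ℕ.* x ℕ.+ k , trans (cong₂ _+_ (sym (ℤₚ.pos-* n x)) e) (sym (ℤₚ.pos-+ (n ℕ.* x) k))

dot-zeros : ∀ {n} (a : Vec ℤ n) → (∀ i → lookup a i ≡ 0ℤ) → ∀ u → dot a u ≡ 0ℤ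
dot-zeros [] h [] = refl
dot-zeros (a ∷ as) h (x ∷ u) rewrite h zero = trans (ℤₚ.+-identityˡ _) (dot-zeros as (h ∘ suc) u)

module _ (D : ℕ) .{{D≢0 : NonZero D}} where

  -- Only the number of forms is fixed: cutting changes the dimension, the set and the forms
  -- themselves.
  AllNice : ℕ → Set₁
  AllNice r = ∀ {m} (F : List (Form m)) → List.length F ≡ r →
    ∀ X → Determined F D X → (∀ u → Dec (X u)) → Nice X

  AllNice-0 : AllNice 0
  AllNice-0 {m} [] _ X det dec = periodic-Nice D (List.allFin m) X (λ u v h → det u v [] (λ i → All.lookup h (∈-allFin i))) dec

  module Step (r : ℕ) (IH : AllNice r) where

    -- Isolates the work on one form. The other forms are arbitrary because they get replaced by
    -- their pullbacks at every cut.
    Removable : ∀ {m} → Form m → Set₁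
    Removable {m} f = ∀ F → List.length F ≡ r → ∀ X → Determined (f ∷ F) D X → (∀ u → Dec (X u)) → Nice X

    Removable-const : ∀ {m} (f : Form m) b → (∀ u → nonneg (⟦ f ⟧ u) ≡ b) → Removable f
    Removable-const f b h F len X det = IH F len X (λ u v s → det u v (trans (h u) (sym (h v)) ∷ s))

    Removable-split : ∀ {l₁ l₂ m} (S : Split l₁ l₂ m) (p : Pullback (Split.e₁ S)) (q : Pullback (Split.e₂ S)) (f : Form m) →
      Removable (pull p f) → Removable (pull q f) → Removable f
    Removable-split S p q f R₁ R₂ F len X det dec = Nice-split S
      (R₁ (List.map (pull p) F) (trans (Listₚ.length-map _ F) len) _ (Pullback-Determined p det) (dec ∘ fun (Split.e₁ S)))
      (R₂ (List.map (pull q) F) (trans (Listₚ.length-map _ F) len) _ (Pullback-Determined q det) (dec ∘ fun (Split.e₂ S)))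

    Removable-residue : ∀ {m} (i : Fin m) d .{{_ : NonZero d}} (f : Form m) →
      (∀ s → Removable (pull (scale* i d s) f)) → Removable f
    Removable-residue i d f R F len X det dec = Nice-residue i d λ s →
      R s (List.map (pull (scale* i d s)) F) (trans (Listₚ.length-map _ F) len) _
        (Pullback-Determined (scale* i d s) det) (dec ∘ fun (scaleᴱ i d s))

    -- Over ℤ, z < 0 is the same as -z - 1 ≥ 0, so both forms cut the space in the same place.
    Removable-opposite : ∀ {m} (f g : Form m) → (∀ u → ⟦ g ⟧ u ≡ -1ℤ * ⟦ f ⟧ u + -1ℤ) → Removable g → Removable f
    Removable-opposite f g h R F len X det = R F len X λ { u v (s ∷ ss) → det u v (flip u v s ∷ ss) }
      where
      opposite : ∀ z → nonneg (-1ℤ * z + -1ℤ) ≡ not (nonneg z)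
      opposite (+ zero)  = refl
      opposite (+ suc n) = refl
      opposite -[1+ n ]  = cong nonneg (lem n)
        where
        lem : ∀ n → -1ℤ * -[1+ n ] + -1ℤ ≡ + n
        lem n rewrite ℕₚ.+-identityʳ n = refl
      flip : ∀ u v → Same u v g → Same u v f
      flip u v s = Boolₚ.not-injective (trans (sym (opposite (⟦ f ⟧ u)))
        (trans (cong nonneg (sym (h u))) (trans s (trans (cong nonneg (h v)) (opposite (⟦ f ⟧ v))))))

    -- Peeling a variable with positive coefficient either drops the variable or increases the constant.
    Nonneg-Removable : ∀ m k (a : Vec ℤ m) c → Nonneg a → 0ℤ ℤ.≤ c + + k → Removable (a , c)
    Nonneg-Removable m k a (+ c) h le = Removable-const (a , + c) true λ u →
      let (n , e) = dot-Nonneg a h u in cong (λ d → nonneg (d + + c)) e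
    Nonneg-Removable m zero a -[1+ c ] h ()
    Nonneg-Removable zero (suc k) [] -[1+ c ] h le = Removable-const ([] , -[1+ c ]) false λ { [] → refl }
    Nonneg-Removable (suc m) (suc k) a c@(-[1+ _ ]) h le with Finₚ.any? (λ i → ¬? (lookup a i ℤₚ.≟ 0ℤ))
    ... | no ¬any = Removable-const (a , c) false λ u → cong (λ d → nonneg (d + c))
      (dot-zeros a (λ i → decidable-stable (lookup a i ℤₚ.≟ 0ℤ) (λ ne → ¬any (i , ne))) u)
    ... | yes (i , a≢0) with nonneg⇒+ (lookup a i) (h i)
    ... | zero , e = ⊥-elim (a≢0 e)
    ... | suc n , e = Removable-split (peelSplit i) (zero* i) (scale* i 1 1) (a , c)
      (Nonneg-Removable m (suc k) (removeAt a i) c (λ j → trans (cong nonneg (lookup-removeAt a i j)) (h (punchIn i j))) le)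
      -- The constant gains the coefficient n + 1 ≥ 1, so the budget k that lifts it to 0 drops by
      -- one.
      (Nonneg-Removable (suc m) k (updateAt a i (1ℤ *_)) (lookup a i * 1ℤ + c) h' le')
      where
      h' : Nonneg (updateAt a i (1ℤ *_))
      h' j with j Finₚ.≟ i
      ... | yes refl = trans (cong nonneg (trans (lookup∘updateAt i a) (ℤₚ.*-identityˡ (lookup a i)))) (h i)
      ... | no j≢i   = trans (cong nonneg (lookup∘updateAt′ j i j≢i a)) (h j)
      le' : 0ℤ ℤ.≤ lookup a i * 1ℤ + c + + k
      le' rewrite e = ℤₚ.≤-trans le (ℤₚ.≤-trans (ℤₚ.i≤i+j (c + + suc k) (+ n)) (ℤₚ.≤-reflexive
        (trans (cong (λ s → c + s + + n) (ℤₚ.pos-+ 1 k)) (trans (lem c (+ k) (+ n)) (cong (λ s → s * 1ℤ + c + + k) (sym (ℤₚ.pos-+ 1 n)))))))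
        where
        lem : ∀ c k n → c + (1ℤ + k) + n ≡ (1ℤ + n) * 1ℤ + c + k
        lem = solve-∀

    shift-budget : ∀ c → 0ℤ ℤ.≤ c + + ∣ c ∣
    shift-budget (+ c)    = ℤ.+≤+ z≤n
    shift-budget -[1+ c ] = ℤₚ.≤-reflexive (sym (ℤₚ.n⊖n≡0 (suc c)))

    same-sign-or-mixed : ∀ {m} (a : Vec ℤ m) →
      Nonneg a ⊎ Nonneg (map (-1ℤ *_) a) ⊎
      (Σ (Fin m) λ i → Σ (Fin m) λ j → Σ ℕ λ p → Σ ℕ λ q → lookup a i ≡ + suc p × lookup a j ≡ -[1+ q ])
    same-sign-or-mixed a with Finₚ.all? (λ i → nonneg (lookup a i) Boolₚ.≟ true)
    ... | yes h = inj₁ h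
    ... | no ¬h with Finₚ.all? (λ i → nonneg (lookup (map (-1ℤ *_) a) i) Boolₚ.≟ true)
    ... | yes h = inj₂ (inj₁ h)
    ... | no ¬h' with Finₚ.¬∀⟶∃¬ _ _ (λ i → nonneg (lookup a i) Boolₚ.≟ true) ¬h
                    | Finₚ.¬∀⟶∃¬ _ _ (λ i → nonneg (lookup (map (-1ℤ *_) a) i) Boolₚ.≟ true) ¬h'
    ... | j , nj | i , ni = let (p , e) = pos (lookup a i) (ni ∘ trans (cong nonneg (lookup-map i (-1ℤ *_) a))) ; (q , e') = neg (lookup a j) nj
                            in inj₂ (inj₂ (i , j , p , q , e , e'))
      where
      pos : ∀ z → nonneg (-1ℤ * z) ≢ true → Σ ℕ λ p → z ≡ + suc p
      pos (+ zero)  h = ⊥-elim (h refl)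
      pos (+ suc p) h = p , refl
      pos -[1+ p ]  h = ⊥-elim (h refl)
      neg : ∀ z → nonneg z ≢ true → Σ ℕ λ q → z ≡ -[1+ q ]
      neg (+ p)    h = ⊥-elim (h refl)
      neg -[1+ q ] h = q , refl

    -- Subtracting the smaller of x_i and x_j from the larger cancels one of two opposite coefficients.
    cancel : ∀ {m} n (a : Vec ℤ m) c i j P → lookup a i ≡ + suc P → lookup a j ≡ -[1+ P ] → nonzeros a ≤ suc n →
      (∀ b d → nonzeros {m} b ≤ n → Removable (b , d)) → Removable (a , c)
    cancel n a c i j P ei ej le R = Removable-split (compareSplit i j i≢j) (shear* i j (i≢j ∘ sym)) (shear* j i i≢j ∘* scale* j 1 1) (a , c)
      -- Substituting x_i + x_j for x_i adds the coefficient of x_i to that of x_j, which makes it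
      -- 0. In the other half the roles are exchanged, and the extra successor multiplies a
      -- coefficient by 1.
      (R _ _ (drop j (lookup a i) ej (trans (cong₂ _+_ ej ei) (ℤₚ.n⊖n≡0 (suc P)))))
      (R _ _ (ℕₚ.≤-trans (ℕₚ.≤-reflexive (keep (updateAt a i (_+ lookup a j)) j)) (drop i (lookup a j) ei (trans (cong₂ _+_ ei ej) (ℤₚ.n⊖n≡0 (suc P))))))
      where
      i≢j : i ≢ j
      i≢j refl with trans (sym ei) ej
      ... | ()
      drop : ∀ k s {z} → lookup a k ≡ z → {{nonzero z ≡ 1}} → lookup a k + s ≡ 0ℤ → nonzeros (updateAt a k (_+ s)) ≤ n
      drop k s {z} ez {{nz}} e0 = ℕₚ.≤-pred (ℕₚ.≤-trans (ℕₚ.≤-reflexive eq) le)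
        where
        eq : suc (nonzeros (updateAt a k (_+ s))) ≡ nonzeros a
        eq = trans (sym (ℕₚ.+-comm _ 1)) (trans (cong (nonzeros (updateAt a k (_+ s)) ℕ.+_) (sym (trans (cong nonzero ez) nz)))
          (trans (nonzeros-updateAt a k (_+ s)) (trans (cong (λ t → nonzeros a ℕ.+ nonzero t) e0) (ℕₚ.+-identityʳ _))))
      keep : ∀ (b : Vec ℤ _) k → nonzeros (updateAt b k (1ℤ *_)) ≡ nonzeros b
      keep b k = ℕₚ.+-cancelʳ-≡ (nonzero (lookup b k)) _ _ (trans (nonzeros-updateAt b k (1ℤ *_))
        (cong (λ t → nonzeros b ℕ.+ nonzero t) (ℤₚ.*-identityˡ (lookup b k))))

    nonzeros-scale : ∀ {m} (a : Vec ℤ m) i d → nonzeros (updateAt a i (+ suc d *_)) ≡ nonzeros a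
    nonzeros-scale a i d = ℕₚ.+-cancelʳ-≡ (nonzero (lookup a i)) _ _
      (trans (nonzeros-updateAt a i (+ suc d *_)) (cong (nonzeros a ℕ.+_) (same (lookup a i))))
      where
      same : ∀ z → nonzero (+ suc d * z) ≡ nonzero z
      same (+ zero)  rewrite ℕₚ.*-zeroʳ d = refl
      same (+ suc n) = refl
      same -[1+ n ]  = refl

    -- Induction on the number of nonzero coefficients: coefficients of one sign are settled by
    -- peeling, and mixed signs allow one coefficient to be cancelled.
    removable : ∀ n {m} (a : Vec ℤ m) c → nonzeros a ≤ n → Removable (a , c)
    removable n {m} a c le with same-sign-or-mixed a
    ... | inj₁ h = Nonneg-Removable m ∣ c ∣ a c h (shift-budget c)
    ... | inj₂ (inj₁ h) = Removable-opposite (a , c) (map (-1ℤ *_) a , -1ℤ * c + -1ℤ) opp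
      (Nonneg-Removable m ∣ -1ℤ * c + -1ℤ ∣ (map (-1ℤ *_) a) (-1ℤ * c + -1ℤ) h (shift-budget (-1ℤ * c + -1ℤ)))
      where
      opp : ∀ u → dot (map (-1ℤ *_) a) u + (-1ℤ * c + -1ℤ) ≡ -1ℤ * (dot a u + c) + -1ℤ
      opp u rewrite dot-* -1ℤ a u = lem (dot a u) c
        where
        lem : ∀ d c → -1ℤ * d + (-1ℤ * c + -1ℤ) ≡ -1ℤ * (d + c) + -1ℤ
        lem = solve-∀
    removable zero a c le | inj₂ (inj₂ (i , j , p , q , ei , ej)) = ⊥-elim (absurd a i ei (ℕₚ.n≤0⇒n≡0 le))
      where
      absurd : ∀ {m} (a : Vec ℤ m) i → lookup a i ≡ + suc p → nonzeros a ≢ 0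
      absurd (_ ∷ a) zero    refl ()
      absurd (x ∷ a) (suc i) e    e' = absurd a i e (ℕₚ.m+n≡0⇒n≡0 (nonzero x) e')
    removable (suc n) a c le | inj₂ (inj₂ (i , j , p , q , ei , ej)) =
      -- The coefficients are p + 1 at i and -(q + 1) at j. Fixing x_i modulo q + 1 and x_j modulo p
      -- + 1 turns them into plus and minus (p + 1)(q + 1), the successor of p + q (p + 1).
      Removable-residue i (suc q) (a , c) λ s → Removable-residue j (suc p) _ λ t →
        cancel n a'' _ i j (p ℕ.+ q ℕ.* suc p) a''i a''j
          (ℕₚ.≤-trans (ℕₚ.≤-reflexive (trans (nonzeros-scale a' j p) (nonzeros-scale a i q))) le) (λ b d → removable n b d)
      where
      i≢j : i ≢ j
      i≢j refl with trans (sym ei) ej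
      ... | ()
      a'  = updateAt a i (+ suc q *_)
      a'' = updateAt a' j (+ suc p *_)
      a''i : lookup a'' i ≡ + suc (p ℕ.+ q ℕ.* suc p)
      a''i = trans (lookup∘updateAt′ i j i≢j a') (trans (lookup∘updateAt i a) (cong (+ suc q *_) ei))
      a''j : lookup a'' j ≡ -[1+ p ℕ.+ q ℕ.* suc p ]
      a''j = trans (lookup∘updateAt j a') (trans (cong (+ suc p *_) (trans (lookup∘updateAt′ j i (i≢j ∘ sym) a) ej))
        (cong -[1+_] (lem p q)))
        where
        lem : ∀ p q → q ℕ.+ p ℕ.* suc q ≡ p ℕ.+ q ℕ.* suc p
        lem = solveℕ-∀

  allNice : ∀ r → AllNice r
  allNice zero = AllNice-0
  allNice (suc r) ((a , c) ∷ F) len X det dec =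
    Step.removable r (allNice r) (nonzeros a) a c ℕₚ.≤-refl F (ℕₚ.suc-injective len) X det dec

-- Existence and uniqueness of the exponent

Presburger⇒Nice : ∀ {m} {X : Vec ℕ m → Set} → Presburger X → Nice X
Presburger⇒Nice {X = X} P = allNice modulus {{modulus≢0}} (List.length forms) forms refl X determined decide
  where open Presburger P

Param⇒DefBij : ∀ {k l} {M : Vec ℕ k → Set} → Param l M → DefBij M l
Param⇒DefBij {l = l} {M} (e , im) = proj₁ (definable e) ,
  (λ x y s → proj₂ (im x) (y , proj₂ (graph x y) s)) ,
  (λ x Mx → let (y , eq) = proj₁ (im x) Mx in y , proj₁ (graph x y) eq ,
     λ y' s → injective e y' y (trans (sym (proj₂ (graph x y') s)) eq)) ,
  λ y → fun e y , (proj₂ (im _) (y , refl) , proj₁ (graph _ y) refl) , λ x' _ s → proj₂ (graph x' y) s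
  where graph = proj₂ (definable e)

theorem8 : (k : ℕ) → 1 ≤ k → (M : Vec ℕ k → Set) → Definable M → Infinite M →
    Σ ℕ λ l → (DefBij M l × (∀ l' → DefBij M l' → l' ≡ l)) × (1 ≤ l × l ≤ k)
theorem8 k _ M (φ , e) inf with Presburger⇒Nice (Presburger-resp (λ x → proj₂ (e x) , proj₁ (e x)) (Sat-Presburger φ))
... | finite L _ h = ⊥-elim (inf (L , λ x → proj₁ (h x)))
... | infinite l P = suc l , (b , λ l' b' → ℕₚ.≤-antisym (DefBij-≤ b' b) (DefBij-≤ b b')) , s≤s z≤n , DefBij⇒≤ b
  where b = Param⇒DefBij P
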